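{- Let $\tau\in\{123,321\}\subset S_3$. Let $n\ge3$, $l\in\{2,\dots,n-1\}$ and $k\in\mathbb{N}$ with $k\ge1$ and $k+l-1\le n$. Then $$P_n^{\mathrm{av}(\tau)}(A^{(n)}_{l;k})=\frac{C_{n-l+1}+C_{k-1}\,C_{n-k-l+1}\,(C_l-1)}{C_n},$$ where $C_j=\frac1{j+1}\binom{2j}{j}$, $j\ge0$, is the $j$th Catalan number.
   Context: $S_n$ is the set of permutations of $[n]=\{1,\dots,n\}$, written $\sigma=\sigma_1\sigma_2\cdots\sigma_n$. For $l\in\{2,\dots,n-1\}$ and $k\ge1$ with $k+l-1\le n$, $A^{(n)}_{l;k}\subset S_n$ is the set of $\sigma\in S_n$ for which there exists $a$ with $\{k,k+1,\dots,k+l-1\}=\{\sigma_a,\sigma_{a+1},\dots,\sigma_{a+l-1}\}$. For $\tau\in S_m$ with $2\le m\le n$, $\sigma\in S_n$ contains $\tau$ as a pattern if there are indices $1\le i_1<\cdots<i_m\le n$ such that for all $1\le j,j'\le m$, $\sigma_{i_j}<\sigma_{i_{j'}}$ if and only if $\tau_j<\tau_{j'}$; otherwise $\sigma$ avoids $\tau$. $S_n(\tau)$ is the set of $\sigma\in S_n$ avoiding $\tau$; if $n<m$, $S_n(\tau)=S_n$. $P_n^{\mathrm{av}(\tau)}$ is the uniform probability measure on $S_n(\tau)$, so $P_n^{\mathrm{av}(\tau)}(A)=|A\cap S_n(\tau)|/|S_n(\tau)|$ for $A\subset S_n$. -}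

module Defs where

open import Data.Fin.Base using (Fin; zero; suc; toℕ; opposite; punchIn; _<_; finToFun; funToFin)
open import Data.Fin.Patterns using (0F; 1F)
open import Data.Fin.Permutation
  using (Permutation′; _⟨$⟩ʳ_; _≈_; id; reverse; insert; remove; insert-remove)
import Data.Fin.Properties as Fin
open import Data.Integer.Base using (+_)
open import Data.List.Base using (List; []; _∷_; allFin; cartesianProductWith; filter; length)
import Data.List.Membership.Setoid as Membership
import Data.List.Membership.Setoid.Properties as Membershipₚ
open import Data.List.Membership.Propositional.Properties using (∈-allFin)
open import Data.List.Relation.Unary.All using ([])
open import Data.List.Relation.Unary.AllPairs using ([]; _∷_)
open import Data.List.Relation.Unary.Any using (Any; here)
import Data.List.Relation.Unary.Unique.Setoid as Unique
import Data.List.Relation.Unary.Unique.Setoid.Properties as Uniqueₚ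
import Data.List.Relation.Unary.Unique.Propositional.Properties as Uniqueₚₚ
open import Data.Nat.Base as ℕ
  using (ℕ; zero; suc; 2+; _+_; _*_; _∸_; _≤_; z≤n; s≤s; z<s; s<s; NonZero; NonTrivial)
open import Data.Nat.Combinatorics using (_C_; nCk+nC[k+1]≡[n+1]C[k+1])
import Data.Nat.Properties as ℕₚ
open import Data.Product.Base using (∃; _×_; _,_)
open import Data.Rational.Base using (ℚ; _/_)
import Data.Rational.Base as ℚ
import Data.Rational.Properties as ℚₚ
open import Function.Bundles using (_⇔_; mk⇔; Equivalence; Injection)
open import Function.Properties.Inverse using (↔⇒↣)
open import Level using (0ℓ)
open import Relation.Binary.Bundles using (Setoid)
open import Relation.Binary.Core using (_Preserves_⟶_)
open import Relation.Binary.Definitions using (tri<; tri≈; tri>)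
open import Relation.Binary.PropositionalEquality
  using (_≡_; refl; sym; trans; cong; subst; subst₂; setoid)
open import Relation.Nullary using (Dec; ¬_; ¬?; contradiction)
open import Relation.Nullary.Decidable using (map′; _×-dec_; _→-dec_)
open import Relation.Unary using (Pred; Decidable; _≐_)
open import Relation.Unary.Properties using (_∩?_)

private
  variable
    m n : ℕ

-- A `Permutation′ n` carries its inverse and proofs, so elements of Sₙ
-- are compared with the pointwise equality `_≈_`.
permutationSetoid : ℕ → Setoid 0ℓ 0ℓ
permutationSetoid n = record
  { Carrier       = Permutation′ n
  ; _≈_           = _≈_
  ; isEquivalence = record
    { refl  = λ _ → refl
    ; sym   = λ p i → sym (p i)
    ; trans = λ p q i → trans (p i) (q i)
    }
  }

-- The permutations are grouped by their first letter.
permutations : ∀ n → List (Permutation′ n)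
permutations zero    = id ∷ []
permutations (suc n) =
  cartesianProductWith (insert zero) (allFin (suc n)) (permutations n)

insert-cong : ∀ {i j} {π ρ : Permutation′ n} → i ≡ j → π ≈ ρ →
              insert zero i π ≈ insert zero j ρ
insert-cong         refl π≈ρ zero    = refl
insert-cong {i = i} refl π≈ρ (suc k) = cong (punchIn i) (π≈ρ k)

insert-injective : ∀ {i j} {π ρ : Permutation′ n} →
                   insert zero i π ≈ insert zero j ρ → i ≡ j × π ≈ ρ
insert-injective {i = i} eq with eq zero
... | refl = refl , λ k → Fin.punchIn-injective i _ _ (eq (suc k))

permutations-complete : ∀ n (σ : Permutation′ n) →
                        Membership._∈_ (permutationSetoid n) σ (permutations n)
permutations-complete zero    σ = here λ ()
permutations-complete (suc n) σ =
  Membershipₚ.∈-resp-≈ (permutationSetoid (suc n)) {xs = permutations (suc n)}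
    {x = insert zero (σ ⟨$⟩ʳ zero) (remove zero σ)} {y = σ}
    (insert-remove zero σ)
    (Membershipₚ.∈-cartesianProductWith⁺
      (setoid (Fin (suc n))) (permutationSetoid n) (permutationSetoid (suc n))
      {f = insert zero}
      (λ {i} {j} {π} {ρ} → insert-cong {i = i} {j} {π} {ρ})
      (∈-allFin (σ ⟨$⟩ʳ zero)) (permutations-complete n (remove zero σ)))

permutations-unique : ∀ n → Unique.Unique (permutationSetoid n) (permutations n)
permutations-unique zero    = [] ∷ []
permutations-unique (suc n) =
  Uniqueₚ.cartesianProductWith⁺
    (setoid (Fin (suc n))) (permutationSetoid n) (permutationSetoid (suc n))
    (insert zero) (λ {i} {j} {π} {ρ} → insert-injective {i = i} {j} {π} {ρ})
    (Uniqueₚₚ.allFin⁺ (suc n)) (permutations-unique n)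

-- |A| for A ⊂ Sₙ, provided that A is closed under `_≈_`.
∣_∣ : {A : Pred (Permutation′ n) 0ℓ} → Decidable A → ℕ
∣_∣ {n = n} A? = length (filter A? (permutations n))

-- `Fin n` stands for [n] = {1,…,n}; `label` is the 1-based name of an
-- element, for positions as well as for values.
label : Fin n → ℕ
label i = suc (toℕ i)

-- {a, a+1, …, a+l-1} ∩ [n]
interval : ℕ → ℕ → Pred (Fin n) 0ℓ
interval a l i = a ≤ label i × label i ≤ a + l ∸ 1

image : Permutation′ n → Pred (Fin n) 0ℓ → Pred (Fin n) 0ℓ
image σ I v = ∃ λ i → I i × σ ⟨$⟩ʳ i ≡ v

-- A⁽ⁿ⁾_{l;k}. The bound on a makes all of σ_a, …, σ_{a+l-1} defined.
Clustered : (n l k : ℕ) → Pred (Permutation′ n) 0ℓ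
Clustered n l k σ = ∃ λ (a : Fin n) →
  label a + l ∸ 1 ≤ n × interval k l ≐ image σ (interval (label a) l)

interval? : ∀ a l → Decidable (interval {n} a l)
interval? a l i = (a ℕₚ.≤? label i) ×-dec (label i ℕₚ.≤? a + l ∸ 1)

≐-dec : {P Q : Pred (Fin n) 0ℓ} → Decidable P → Decidable Q → Dec (P ≐ Q)
≐-dec P? Q? =
  map′ (λ f {i} → f i) (λ f i → f {i}) (Fin.all? λ i → P? i →-dec Q? i)
  ×-dec
  map′ (λ f {i} → f i) (λ f i → f {i}) (Fin.all? λ i → Q? i →-dec P? i)

clustered? : ∀ n l k → Decidable (Clustered n l k)
clustered? n l k σ = Fin.any? λ a →
  (label a + l ∸ 1 ℕₚ.≤? n) ×-dec
  ≐-dec (interval? k l) λ v → Fin.any? λ i →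
    interval? (label a) l i ×-dec (σ ⟨$⟩ʳ i Fin.≟ v)

OccursAt : Permutation′ m → Permutation′ n → Pred (Fin m → Fin n) 0ℓ
OccursAt τ σ ι =
  (ι Preserves _<_ ⟶ _<_) ×
  (∀ j j′ → (σ ⟨$⟩ʳ ι j < σ ⟨$⟩ʳ ι j′) ⇔ (τ ⟨$⟩ʳ j < τ ⟨$⟩ʳ j′))

Contains : Permutation′ m → Pred (Permutation′ n) 0ℓ
Contains τ σ = ∃ (OccursAt τ σ)

-- Sₙ(τ)
Avoids : Permutation′ m → Pred (Permutation′ n) 0ℓ
Avoids τ σ = ¬ Contains τ σ

occursAt? : (τ : Permutation′ m) (σ : Permutation′ n) → Decidable (OccursAt τ σ)
occursAt? τ σ ι =
  map′ (λ f {i} {j} → f i j) (λ f i j → f {i} {j})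
    (Fin.all? λ i → Fin.all? λ j → (i Fin.<? j) →-dec (ι i Fin.<? ι j))
  ×-dec
  (Fin.all? λ i → Fin.all? λ j →
    let p? = σ ⟨$⟩ʳ ι i Fin.<? σ ⟨$⟩ʳ ι j
        q? = τ ⟨$⟩ʳ i Fin.<? τ ⟨$⟩ʳ j
    in map′ (λ (f , g) → mk⇔ f g) (λ e → Equivalence.to e , Equivalence.from e)
         ((p? →-dec q?) ×-dec (q? →-dec p?)))

occursAt-resp : (τ : Permutation′ m) (σ : Permutation′ n) {ι κ : Fin m → Fin n} →
                (∀ i → ι i ≡ κ i) → OccursAt τ σ ι → OccursAt τ σ κ
occursAt-resp τ σ {ι} {κ} eq (inc , iso) =
  (λ {i} {j} i<j → subst₂ _<_ (eq i) (eq j) (inc i<j)) ,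
  λ i j → subst₂ (λ x y → (σ ⟨$⟩ʳ x < σ ⟨$⟩ʳ y) ⇔ (τ ⟨$⟩ʳ i < τ ⟨$⟩ʳ j))
            (eq i) (eq j) (iso i j)

contains? : (τ : Permutation′ m) → Decidable (Contains {m} {n} τ)
contains? {m} {n} τ σ =
  map′ (λ (c , o) → finToFun c , o)
       (λ (ι , o) → funToFin ι ,
          occursAt-resp τ σ (λ i → sym (Fin.finToFun-funToFin ι i)) o)
       (Fin.any? {n = n ℕ.^ m} λ c → occursAt? τ σ (finToFun c))

avoids? : (τ : Permutation′ m) → Decidable (Avoids {m} {n} τ)
avoids? τ σ = ¬? (contains? τ σ)

avoids-resp : (τ : Permutation′ m) {σ ρ : Permutation′ n} →
              σ ≈ ρ → Avoids τ σ → Avoids τ ρ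
avoids-resp τ eq av (ι , inc , iso) = av (ι , inc , λ i j →
  subst₂ (λ x y → (x < y) ⇔ (τ ⟨$⟩ʳ i < τ ⟨$⟩ʳ j))
    (sym (eq (ι i))) (sym (eq (ι j))) (iso i j))

opposite-anti : {i j : Fin n} → i < j → opposite j < opposite i
opposite-anti {n} {i} {j} i<j =
  subst₂ ℕ._<_ (sym (Fin.opposite-prop j)) (sym (Fin.opposite-prop i))
    (ℕₚ.∸-monoʳ-< (s<s i<j) (Fin.toℕ<n j))

∃-avoider : ∀ n (τ : Permutation′ (2+ m)) → ∃ λ (σ : Permutation′ n) → Avoids τ σ
∃-avoider n τ with Fin.<-cmp (τ ⟨$⟩ʳ 0F) (τ ⟨$⟩ʳ 1F)
... | tri< τ₀<τ₁ _ _ = reverse , λ (ι , inc , iso) →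
  Fin.<-asym (opposite-anti (inc {0F} {1F} z<s)) (Equivalence.from (iso 0F 1F) τ₀<τ₁)
... | tri> _ _ τ₁<τ₀ = id , λ (ι , inc , iso) →
  Fin.<-asym (inc {0F} {1F} z<s) (Equivalence.from (iso 1F 0F) τ₁<τ₀)
... | tri≈ _ τ₀≡τ₁ _ = contradiction (Injection.injective (↔⇒↣ τ) τ₀≡τ₁) λ ()

member⇒nonZero : ∀ {a} {A : Set a} {P : Pred A 0ℓ} {xs : List A} →
                 Any P xs → NonZero (length xs)
member⇒nonZero {xs = _ ∷ _} _ = _

∣avoids∣-nonZero : ∀ n (τ : Permutation′ m) .{{_ : NonTrivial m}} →
                   NonZero ∣ avoids? {m} {n} τ ∣
∣avoids∣-nonZero {2+ m} n τ with ∃-avoider n τ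
... | σ , av = member⇒nonZero {P = σ ≈_}
  (Membershipₚ.∈-filter⁺ (permutationSetoid n) (avoids? τ)
    (λ {σ} {ρ} → avoids-resp τ {σ} {ρ}) {v = σ} (permutations-complete n σ) av)

-- P_n^{av(τ)} (A) = |A ∩ Sₙ(τ)| / |Sₙ(τ)|
P[_,_] : ∀ n (τ : Permutation′ m) .{{_ : NonTrivial m}}
         {A : Pred (Permutation′ n) 0ℓ} → Decidable A → ℚ
P[ n , τ ] A? = (+ ∣ A? ∩? avoids? τ ∣ / ∣ avoids? {n = n} τ ∣) {{∣avoids∣-nonZero n τ}}

τ₁₂₃ τ₃₂₁ : Permutation′ 3
τ₁₂₃ = id
τ₃₂₁ = reverse

catalan : ℕ → ℚ
catalan j = + ((2 * j) C j) / suc j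

nCk-nonZero : ∀ {n k} → k ≤ n → NonZero (n C k)
nCk-nonZero {n}     {zero}  _         = _
nCk-nonZero {suc n} {suc k} (s≤s k≤n) =
  subst NonZero (nCk+nC[k+1]≡[n+1]C[k+1] n k)
    (ℕ.>-nonZero (ℕₚ.≤-trans (ℕ.>-nonZero⁻¹ _ {{nCk-nonZero k≤n}}) (ℕₚ.m≤m+n _ _)))

catalan-nonZero : ∀ j → ℚ.NonZero (catalan j)
catalan-nonZero j = ℚₚ.pos⇒nonZero (catalan j)
  {{ℚₚ.normalize-pos ((2 * j) C j) (suc j) {{_}} {{nCk-nonZero (ℕₚ.m≤m+n j _)}}}}

{-# OPTIONS --safe #-}
module Submission where

-- A permutation is read through its Lehmer code, in which a 321 is absent iff
-- every letter is at most the number of smallest values 0, 1, … that appear in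
-- order to its right; this makes the avoiders the nodes of the Catalan generating tree,
-- whose levels are counted by ballot numbers. Reversing positions reduces 123 to 321.
--
-- In a clustered 321-avoider the block of l values is either increasing, and then
-- contracts to a single value (C_{n-l+1} cases), or contains a descent. A descent
-- allows no larger value before it and no smaller value after it, so the
-- permutation is then a direct sum α ⊕ ρ ⊕ γ with ρ ≠ id, whose code is the
-- concatenation of the three codes (C_{k-1} (C_l - 1) C_{n-k-l+1} cases).

open import Defs
open import Data.Fin.Base as Fin using (Fin; zero; suc; toℕ; fromℕ<; opposite; punchIn)
open import Data.Fin.Patterns using (0F; 1F; 2F)
open import Data.Fin.Permutation
  using (Permutation′; _⟨$⟩ʳ_; _≈_; _∘ₚ_; id; flip; reverse; insert; remove;
         insert-remove; remove-insert; inverseˡ; inverseʳ)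
import Data.Fin.Properties as Finₚ
import Data.Integer.Base as ℤ
import Data.Integer.Properties as ℤₚ
open import Data.List.Base
  using (List; []; _∷_; _++_; length; replicate; map; concatMap; upTo; applyUpTo;
         filter; cartesianProduct)
open import Data.List.Membership.Propositional using (_∈_; find; lose)
open import Data.List.Membership.Propositional.Properties
  using (∈-map⁺; ∈-map⁻; ∈-++⁺ˡ; ∈-++⁺ʳ; ∈-++⁻; ∈-concatMap⁺; ∈-concatMap⁻;
         ∈-cartesianProduct⁺; ∈-cartesianProduct⁻; ∈-filter⁺; ∈-filter⁻; ∈-upTo⁺;
         ∈-upTo⁻)
open import Data.List.Membership.Propositional.Properties.WithK using (unique∧set⇒bag)
open import Data.List.Properties
  using (length-++; length-replicate; length-map; ∷-injective; ∷-injectiveˡ;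
         ∷-injectiveʳ; ≡-dec; map-++; map-∘; map-cong; map-applyUpTo; applyUpTo-∷ʳ)
open import Data.List.Relation.Binary.BagAndSetEquality using (∼bag⇒↭)
open import Data.List.Relation.Binary.Permutation.Propositional.Properties
  using (↭-length)
open import Data.List.Relation.Unary.All as All using ([]; _∷_)
import Data.List.Relation.Unary.All.Properties as Allₚ
open import Data.List.Relation.Unary.AllPairs using ([]; _∷_)
open import Data.List.Relation.Unary.Any using (here; there)
open import Data.List.Relation.Unary.Unique.Propositional using (Unique)
import Data.List.Relation.Unary.Unique.Propositional.Properties as Uniqueₚ
import Data.List.Relation.Unary.Unique.Setoid.Properties as Uniqueₛ
open import Data.Nat.Base
  using (ℕ; zero; suc; 2+; pred; _+_; _*_; _∸_; _≤_; _<_; z≤n; s≤s; s≤s⁻¹; z<s; s<s;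
         NonZero)
open import Data.Nat.Combinatorics
  using (_C_; nC1≡n; nCk≡nC[n∸k]; nCk+nC[k+1]≡[n+1]C[k+1])
import Data.Nat.Coprimality as Coprimality
open import Data.Nat.ListAction using (sum)
open import Data.Nat.ListAction.Properties using (sum-++)
open import Data.Nat.Properties
open import Data.Nat.Tactic.RingSolver using (solve-∀)
open import Data.Product.Base using (∃; ∃₂; _×_; _,_; proj₁; proj₂)
open import Data.Rational.Base as ℚ
  using (ℚ; mkℚ; _/_; 1ℚ; _÷_) renaming (_+_ to _+ℚ_; _*_ to _*ℚ_; _-_ to _-ℚ_)
import Data.Rational.Properties as ℚₚ
open import Data.Rational.Unnormalised.Base using (mkℚᵘ; *≡*)
open import Data.Sum.Base using (_⊎_; inj₁; inj₂)
open import Data.Unit.Base using (⊤; tt)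
open import Function.Base using (_∘_)
open import Function.Bundles using (_⇔_; mk⇔; Equivalence; Injection)
open import Function.Construct.Composition using (_⇔-∘_)
open import Function.Construct.Symmetry using (⇔-sym)
open import Function.Properties.Inverse using (↔⇒↣)
open import Level using (0ℓ)
open import Relation.Binary.Definitions using (tri<; tri≈; tri>)
open import Relation.Binary.PropositionalEquality
  using (_≡_; _≢_; refl; sym; trans; cong; cong₂; subst; subst₂; setoid;
         module ≡-Reasoning)
open import Relation.Nullary using (¬_; ¬?; contradiction; yes; no)
open import Relation.Unary using (Pred; Decidable)
open import Relation.Unary.Properties using (_∩?_)

open Equivalence

private variable
  c c′ d d′ β : List ℕ
  i k l m n p x y : ℕ
  X Y : Set
  xs ys : List X

-- Codes are compared by `_≡_`, whereas permutations are compared only pointwise, so cardinalities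
-- become lengths of duplicate-free lists with the same members. The single test `i ≤ bound c`
-- decides whether a letter may be put in front, so a construction on codes is understood once its
-- effect on `bound` is known: `bound-++` for direct sums, `Inflates-bound` for inflations. In the
-- counting there are `k` values below the block, `p + 1` in it and `r` above it, so that the sizes
-- n-l+1 and n-k-l+1 of the theorem become `suc k + r` and `r`.

-- Lehmer codes and 321-avoidance

pin : ℕ → ℕ → ℕ
pin zero    v       = suc v
pin (suc i) zero    = zero
pin (suc i) (suc v) = suc (pin i v)

pin-< : ∀ {i v} → v < i → pin i v ≡ v
pin-< {suc i} {zero}  _         = refl
pin-< {suc i} {suc v} (s≤s v<i) = cong suc (pin-< v<i)

pin-≥ : ∀ {i v} → i ≤ v → pin i v ≡ suc v
pin-≥ {zero}          _         = refl
pin-≥ {suc i} {suc v} (s≤s i≤v) = cong suc (pin-≥ i≤v)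

pin-mono-< : ∀ i {v w} → v < w → pin i v < pin i w
pin-mono-< zero                    v<w       = s≤s v<w
pin-mono-< (suc i) {zero}  {suc w} _         = z<s
pin-mono-< (suc i) {suc v} {suc w} (s≤s v<w) = s≤s (pin-mono-< i v<w)

pin-cancel-< : ∀ i {v w} → pin i v < pin i w → v < w
pin-cancel-< zero                    (s≤s p) = p
pin-cancel-< (suc i) {zero}  {suc w} _       = z<s
pin-cancel-< (suc i) {suc v} {suc w} (s≤s p) = s≤s (pin-cancel-< i p)

v≤pin : ∀ i v → v ≤ pin i v
v≤pin zero    v       = n≤1+n v
v≤pin (suc i) zero    = z≤n
v≤pin (suc i) (suc v) = s≤s (v≤pin i v)

-- The values of the permutation with a given Lehmer code; junk value 0 past the end.
val : List ℕ → ℕ → ℕ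
val []      _       = 0
val (i ∷ _) zero    = i
val (i ∷ c) (suc j) = pin i (val c j)

Valid : List ℕ → Set
Valid []      = ⊤
Valid (i ∷ c) = i ≤ length c × Valid c

-- For the code of a 321-avoiding permutation, the largest b ≤ n such that the
-- values 0, …, b − 1 occur in increasing order; exactly the letters 0, …, b
-- can then be put in front without creating a 321.
bound : List ℕ → ℕ
bound []          = 0
bound (zero  ∷ c) = suc (bound c)
bound (suc i ∷ c) = suc i

Av : List ℕ → Set
Av []      = ⊤
Av (i ∷ c) = i ≤ bound c × Av c

Av⇒bound≤length : ∀ c → Av c → bound c ≤ length c
Av⇒bound≤length []          _          = z≤n
Av⇒bound≤length (zero  ∷ c) (_ , av)   = s≤s (Av⇒bound≤length c av)
Av⇒bound≤length (suc i ∷ c) (i≤ , av)  = ≤-trans i≤ (≤-trans (Av⇒bound≤length c av) (n≤1+n _))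

Av⇒Valid : ∀ c → Av c → Valid c
Av⇒Valid []      _         = tt
Av⇒Valid (i ∷ c) (i≤ , av) = ≤-trans i≤ (Av⇒bound≤length c av) , Av⇒Valid c av

No321 : List ℕ → Set
No321 c = ∀ {i j h} → i < j → j < h → h < length c →
          val c j < val c i → ¬ val c h < val c j

-- Every value below the bound has all smaller values to its left, so it tops no inversion. In the
-- induction a nonzero first letter is itself the new bound and, by `i≤`, at most the old one.
bound≤inversion : ∀ c → Av c → ∀ {j h} → j < h → h < length c →
                  val c h < val c j → bound c ≤ val c j
bound≤inversion (zero ∷ c) (_ , av) {suc j} {suc h} (s≤s j<h) (s≤s h<) p =
  s≤s (bound≤inversion c av j<h h< (pin-cancel-< 0 p))
bound≤inversion (suc i ∷ c) av       {zero}  {suc h} _ _ p = ≤-refl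
bound≤inversion (suc i ∷ c) (i≤ , av) {suc j} {suc h} (s≤s j<h) (s≤s h<) p =
  ≤-trans i≤ (≤-trans (bound≤inversion c av j<h h< (pin-cancel-< (suc i) p)) (v≤pin _ _))

Av⇒No321 : ∀ c → Av c → No321 c
Av⇒No321 (i ∷ c) (i≤ , av) {zero} {suc j} {suc h} _ (s≤s j<h) (s≤s h<) p q =
  <⇒≱ p (≤-trans i≤ (≤-trans
    (bound≤inversion c av j<h h< (pin-cancel-< i q)) (v≤pin i _)))
Av⇒No321 (i ∷ c) (_ , av) {suc g} {suc j} {suc h} (s≤s g<j) (s≤s j<h) (s≤s h<) p q =
  Av⇒No321 c av g<j j<h h< (pin-cancel-< i p) (pin-cancel-< i q)

position-of-0 : ∀ c → Valid c → 0 < length c → ∃ λ h → h < length c × val c h ≡ 0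
position-of-0 (zero ∷ c)  _        _ = 0 , z<s , refl
position-of-0 (suc i ∷ c) (i< , v) _ with position-of-0 c v (≤-trans z<s i<)
... | h , h< , eq = suc h , s≤s h< , cong (pin (suc i)) eq

-- This makes `bound` sharp: a letter above it, put in front, completes a 321 with the inversion
-- found here. Behind a nonzero first letter the value 0 serves as the smaller entry.
inversion-at-bound : ∀ c → Valid c → bound c < length c →
  ∃₂ λ j h → j < h × h < length c × val c j ≡ bound c × val c h < bound c
inversion-at-bound (zero ∷ c) (_ , v) (s≤s b<) with inversion-at-bound c v b<
... | j , h , j<h , h< , eq , p = suc j , suc h , s≤s j<h , s≤s h< , cong suc eq , s≤s p
inversion-at-bound (suc i ∷ c) (i≤ , v) _ with position-of-0 c v (≤-trans z<s i≤)
... | h , h< , eq = 0 , suc h , z<s , s≤s h< , refl ,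
  subst (λ w → pin (suc i) w < suc i) (sym eq) z<s

No321⇒Av : ∀ c → Valid c → No321 c → Av c
No321⇒Av []      _        _  = tt
No321⇒Av (i ∷ c) (i≤ , v) ¬321 =
  head , No321⇒Av c v (λ g<j j<h h< p q →
    ¬321 (s≤s g<j) (s≤s j<h) (s≤s h<) (pin-mono-< i p) (pin-mono-< i q))
  where
  head : i ≤ bound c
  head with i ≤? bound c
  ... | yes i≤b = i≤b
  -- The new first value `i` is the 3; the inversion in `c` supplies the 2, which lies below `i` and
  -- is therefore fixed by `pin i`, and the 1.
  ... | no  i≰b with inversion-at-bound c v (<-≤-trans (≰⇒> i≰b) i≤)
  ...   | j , h , j<h , h< , eq , p = contradiction
    (pin-mono-< i (subst (val c h <_) (sym eq) p))
    (¬321 z<s (s≤s j<h) (s≤s h<)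
      (subst (_< i) (sym (trans (cong (pin i) eq) (pin-< (≰⇒> i≰b)))) (≰⇒> i≰b)))

-- Clusters

-- Deleting a first value inside the block lowers the values above it by one, so the rest of the
-- block keeps its lower end `k` and only its length drops.
data Starts (k : ℕ) : ℕ → List ℕ → Set where
  []  : Starts k 0 c
  _∷_ : k ≤ i × i ≤ k + l → Starts k l c → Starts k (suc l) (i ∷ c)

-- The letters in front of the block are peeled off one at a time: deleting a value below the block
-- shifts it down by one, deleting a value above leaves it in place.
data Cl (l : ℕ) : ℕ → List ℕ → Set where
  here  : Starts k l c → Cl l k c
  below : i ≤ k → Cl l k c → Cl l (suc k) (i ∷ c)
  above : k + l ≤ i → Cl l k c → Cl l k (i ∷ c)

_∈[_,+_⟩ : ℕ → ℕ → ℕ → Set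
v ∈[ k ,+ l ⟩ = k ≤ v × v < k + l

Window : ℕ → ℕ → List ℕ → Set
Window l k c = ∃ λ a → a + l ≤ length c ×
  (∀ j → j < length c → (j ∈[ a ,+ l ⟩) ⇔ (val c j ∈[ k ,+ l ⟩))

pin-inside : k ≤ i × i ≤ k + l → ∀ v → (v ∈[ k ,+ l ⟩) ⇔ (pin i v ∈[ k ,+ suc l ⟩)
pin-inside {k} {i} {l} (k≤i , i≤) v with v <? i
... | yes v<i rewrite pin-< v<i | +-suc k l = mk⇔
  (λ (p , q) → p , m<n⇒m<1+n q)
  (λ (p , _) → p , <-≤-trans v<i i≤)
... | no v≮i rewrite pin-≥ (≮⇒≥ v≮i) | +-suc k l = mk⇔
  (λ (p , q) → m≤n⇒m≤1+n p , s≤s q)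
  (λ (_ , q) → ≤-trans k≤i (≮⇒≥ v≮i) , s≤s⁻¹ q)

pin-below : i ≤ k → ∀ v → (v ∈[ k ,+ l ⟩) ⇔ (pin i v ∈[ suc k ,+ l ⟩)
pin-below {i} {k} i≤k v with v <? i
... | yes v<i rewrite pin-< v<i = mk⇔
  (λ (p , _) → contradiction p (<⇒≱ (<-≤-trans v<i i≤k)))
  (λ (p , _) → contradiction (<⇒≤ p) (<⇒≱ (<-≤-trans v<i i≤k)))
... | no v≮i rewrite pin-≥ (≮⇒≥ v≮i) = mk⇔
  (λ (p , q) → s≤s p , s≤s q) (λ (p , q) → s≤s⁻¹ p , s≤s⁻¹ q)

pin-above : k + l ≤ i → ∀ v → (v ∈[ k ,+ l ⟩) ⇔ (pin i v ∈[ k ,+ l ⟩)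
pin-above {k} {l} {i} i≥ v with v <? i
... | yes v<i rewrite pin-< v<i = mk⇔ (λ p → p) (λ p → p)
... | no v≮i rewrite pin-≥ (≮⇒≥ v≮i) = mk⇔
  (λ (_ , q) → contradiction (≤-trans i≥ (≮⇒≥ v≮i)) (<⇒≱ q))
  (λ (_ , q) → contradiction (≤-trans i≥ (≮⇒≥ v≮i)) (<⇒≱ (<-trans (n<1+n v) q)))

⟨+-suc : ∀ {v a} → (v ∈[ a ,+ l ⟩) ⇔ (suc v ∈[ suc a ,+ l ⟩)
⟨+-suc = mk⇔ (λ (p , q) → s≤s p , s≤s q) (λ (p , q) → s≤s⁻¹ p , s≤s⁻¹ q)

Starts⇒Window : Starts k l c → l ≤ length c ×
  (∀ j → j < length c → (j < l) ⇔ (val c j ∈[ k ,+ l ⟩))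
Starts⇒Window {k} [] = z≤n , λ j _ → mk⇔ (λ ()) λ (p , q) →
  contradiction p (<⇒≱ (subst (_ <_) (+-identityʳ k) q))
Starts⇒Window {k} {suc l} (i∈ ∷ s) with Starts⇒Window s
... | l≤ , iff = s≤s l≤ , λ where
  zero    _        → mk⇔
    (λ _ → proj₁ i∈ , ≤-trans (s≤s (proj₂ i∈)) (≤-reflexive (sym (+-suc k l))))
    (λ _ → z<s)
  (suc j) (s≤s j<) → mk⇔
    (to (pin-inside i∈ _) ∘ to (iff j j<) ∘ s≤s⁻¹)
    (s≤s ∘ from (iff j j<) ∘ from (pin-inside i∈ _))

Window⇒Starts : ∀ l c → l ≤ length c →
  (∀ j → j < length c → (j < l) ⇔ (val c j ∈[ k ,+ l ⟩)) → Starts k l c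
Window⇒Starts zero    c       _        _   = []
Window⇒Starts {k} (suc l) (i ∷ c) (s≤s l≤) iff =
  i∈ ∷ Window⇒Starts l c l≤ λ j j< → mk⇔
    (from (pin-inside i∈ _) ∘ to (iff (suc j) (s≤s j<)) ∘ s≤s)
    (s≤s⁻¹ ∘ from (iff (suc j) (s≤s j<)) ∘ to (pin-inside i∈ _))
  where
  i∈ : k ≤ i × i ≤ k + l
  i∈ with to (iff 0 z<s) z<s
  ... | p , q = p , s≤s⁻¹ (subst (i <_) (+-suc k l) q)

Cl⇒Window : Cl l k c → Window l k c
Cl⇒Window (here s) with Starts⇒Window s
... | l≤ , iff = 0 , l≤ , λ j j< → mk⇔ (to (iff j j<) ∘ proj₂) (λ p → z≤n , from (iff j j<) p)
Cl⇒Window (below i≤k cl) with Cl⇒Window cl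
... | a , a≤ , iff = suc a , s≤s a≤ , λ where
  zero    _        → mk⇔ (λ ()) (λ (p , _) → contradiction i≤k (<⇒≱ p))
  (suc j) (s≤s j<) → pin-below i≤k _ ⇔-∘ (iff j j< ⇔-∘ ⇔-sym ⟨+-suc)
Cl⇒Window (above i≥ cl) with Cl⇒Window cl
... | a , a≤ , iff = suc a , s≤s a≤ , λ where
  zero    _        → mk⇔ (λ ()) (λ (_ , q) → contradiction i≥ (<⇒≱ q))
  (suc j) (s≤s j<) → pin-above i≥ _ ⇔-∘ (iff j j< ⇔-∘ ⇔-sym ⟨+-suc)

Window⇒Cl : ∀ l k c → Window l k c → Cl l k c
Window⇒Cl l k c (zero , l≤ , iff) = here (Window⇒Starts l c l≤ λ j j< →
  mk⇔ (λ p → to (iff j j<) (z≤n , p)) (proj₂ ∘ from (iff j j<)))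
Window⇒Cl l k (i ∷ c) (suc a , s≤s a≤ , iff) with i <? k | i <? k + l
Window⇒Cl l (suc k) (i ∷ c) (suc a , s≤s a≤ , iff) | yes (s≤s i≤k) | _ =
  below i≤k (Window⇒Cl l k c (a , a≤ , λ j j< →
    ⇔-sym (pin-below i≤k _) ⇔-∘ (iff (suc j) (s≤s j<) ⇔-∘ ⟨+-suc)))
... | no _  | no i≮ =
  above (≮⇒≥ i≮) (Window⇒Cl l k c (a , a≤ , λ j j< →
    ⇔-sym (pin-above (≮⇒≥ i≮) _) ⇔-∘ (iff (suc j) (s≤s j<) ⇔-∘ ⟨+-suc)))
-- The first position lies before the window, so its value cannot lie in the block.
... | no i≮k | yes i< with from (iff 0 z<s) (≮⇒≥ i≮k , i<)
...   | () , _

-- Inflations and direct sums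

-- `bound` reads a code up to its first nonzero letter and adds that letter to the number of zeros
-- before it. Either `α` is all zeros and the reading goes on into `β`, or it stops inside `α`.
bound-++ : ∀ α β →
  (α ≡ replicate (length α) 0 × bound α ≡ length α × bound (α ++ β) ≡ length α + bound β)
  ⊎ bound (α ++ β) ≡ bound α
bound-++ []          β = inj₁ (refl , refl , refl)
bound-++ (suc i ∷ α) β = inj₂ refl
bound-++ (zero ∷ α)  β with bound-++ α β
... | inj₁ (p , q , r) = inj₁ (cong (0 ∷_) p , cong suc q , cong suc r)
... | inj₂ p           = inj₂ (cong suc p)

≤bound-++ : ∀ α → i ≤ length α → (i ≤ bound α) ⇔ (i ≤ bound (α ++ β))
≤bound-++ {i} {β} α i≤ with bound-++ α β
... | inj₁ (_ , q , r) = mk⇔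
  (λ _ → ≤-trans (≤-trans i≤ (m≤m+n _ _)) (≤-reflexive (sym r)))
  (λ _ → ≤-trans i≤ (≤-reflexive (sym q)))
... | inj₂ eq = mk⇔ (subst (i ≤_) (sym eq)) (subst (i ≤_) eq)

Av-++ : ∀ α → Av α → Av β → Av (α ++ β)
Av-++ []      _         avβ = avβ
Av-++ (i ∷ α) (i≤ , av) avβ =
  to (≤bound-++ α (≤-trans i≤ (Av⇒bound≤length α av))) i≤ , Av-++ α av avβ

length≤bound⇒identity : ∀ ρ → Av ρ → length ρ ≤ bound ρ → ρ ≡ replicate (length ρ) 0
length≤bound⇒identity []          _         _       = refl
length≤bound⇒identity (zero ∷ ρ)  (_ , av)  (s≤s p) = cong (0 ∷_) (length≤bound⇒identity ρ av p)
length≤bound⇒identity (suc i ∷ ρ) (i≤ , av) (s≤s p) =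
  contradiction (≤-trans i≤ (Av⇒bound≤length ρ av)) (≤⇒≯ p)

-- The action of an inflation on the bound: if the value `k` belongs to the ordered initial values
-- 0, ..., `x` - 1, the `p` new values join them; otherwise these values all lie below `k` and
-- nothing changes.
stretch : ℕ → ℕ → ℕ → ℕ
stretch p k x with x ≤? k
... | yes _ = x
... | no  _ = x + p

stretch-≤ : x ≤ k → stretch p k x ≡ x
stretch-≤ {x} {k} x≤k with x ≤? k
... | yes _  = refl
... | no x≰k = contradiction x≤k x≰k

stretch-> : k < x → stretch p k x ≡ x + p
stretch-> {k} {x} k<x with x ≤? k
... | yes x≤k = contradiction x≤k (<⇒≱ k<x)
... | no _    = refl

stretch-suc : stretch p (suc k) (suc x) ≡ suc (stretch p k x)
stretch-suc {p} {k} {x} with x ≤? k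
... | yes x≤k = stretch-≤ (s≤s x≤k)
... | no  x≰k = stretch-> (s≤s (≰⇒> x≰k))

≤-stretch : i ≤ k → (i ≤ x) ⇔ (i ≤ stretch p k x)
≤-stretch {i} {k} {x} {p} i≤k with x ≤? k
... | yes _  = mk⇔ (λ q → q) (λ q → q)
... | no x≰k = mk⇔ (λ q → ≤-trans q (m≤m+n x p)) (λ _ → ≤-trans i≤k (<⇒≤ (≰⇒> x≰k)))

+≤-stretch : k < i → (i ≤ x) ⇔ (i + p ≤ stretch p k x)
+≤-stretch {k} {i} {x} {p} k<i with x ≤? k
... | yes x≤k = mk⇔
  (λ q → contradiction (≤-trans q x≤k) (<⇒≱ k<i))
  (λ q → contradiction (≤-trans (≤-trans (m≤m+n i p) q) x≤k) (<⇒≱ k<i))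
... | no _    = mk⇔ (+-monoˡ-≤ p) (+-cancelʳ-≤ p i x)

-- Replaces the value k by the increasing run k, …, k + p, which in a Lehmer code
-- reads as p + 1 letters k.
data Inflates (p : ℕ) : ℕ → List ℕ → List ℕ → Set where
  below : i ≤ k → Inflates p k d c → Inflates p (suc k) (i ∷ d) (i ∷ c)
  at    : Inflates p k (k ∷ d) (replicate (suc p) k ++ d)
  above : k < i → Inflates p k d c → Inflates p k (i ∷ d) (i + p ∷ c)

-- Only meaningful where `Inflates` is inhabited, that is for k < length d.
inflate : ℕ → ℕ → List ℕ → List ℕ
inflate p k []      = []
inflate p k (i ∷ d) with <-cmp i k
... | tri< _ _ _ = i ∷ inflate p (pred k) d
... | tri≈ _ _ _ = replicate (suc p) k ++ d
... | tri> _ _ _ = i + p ∷ inflate p k d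

-- The relation carries the inductions and the function produces the list to be counted; `inflates`
-- is the other half of their agreement.
Inflates⇒≡ : Inflates p k d c → inflate p k d ≡ c
Inflates⇒≡ {p} {suc k} {i ∷ d} (below i≤k r) with <-cmp i (suc k)
... | tri< _ _ _  = cong (i ∷_) (Inflates⇒≡ r)
... | tri≈ ≮ _ _  = contradiction (s≤s i≤k) ≮
... | tri> ≮ _ _  = contradiction (s≤s i≤k) ≮
Inflates⇒≡ {p} {k} at with <-cmp k k
... | tri< _ ≢ _  = contradiction refl ≢
... | tri≈ _ _ _  = refl
... | tri> _ ≢ _  = contradiction refl ≢
Inflates⇒≡ {p} {k} {i ∷ d} (above k<i r) with <-cmp i k
... | tri< _ _ ≯  = contradiction k<i ≯
... | tri≈ _ _ ≯  = contradiction k<i ≯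
... | tri> _ _ _  = cong (i + p ∷_) (Inflates⇒≡ r)

inflates : ∀ p k d → Valid d → k < length d → Inflates p k d (inflate p k d)
inflates p k (i ∷ d) (i≤ , v) k< with <-cmp i k
inflates p (suc k) (i ∷ d) (i≤ , v) (s≤s k<) | tri< (s≤s i≤k) _ _ =
  below i≤k (inflates p k d v k<)
... | tri≈ _ refl _ = at
... | tri> _ _ k<i  = above k<i (inflates p k d v (<-≤-trans k<i i≤))

replicate-++-injective : ∀ n {d d′ : List ℕ} →
  replicate n x ++ d ≡ replicate n x ++ d′ → d ≡ d′
replicate-++-injective zero    eq = eq
replicate-++-injective (suc n) eq = replicate-++-injective n (proj₂ (∷-injective eq))

-- The first letter of the inflated code reveals the constructor: it is smaller than the start of
-- the run for `below`, equal to it for `at`, larger for `above`.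
Inflates-injective : Inflates p k d c → Inflates p k d′ c′ → c ≡ c′ → d ≡ d′
Inflates-injective (below _ r) (below _ r′) eq with ∷-injective eq
... | refl , eq′ = cong (_ ∷_) (Inflates-injective r r′ eq′)
Inflates-injective (below i≤k _) at eq with ∷-injective eq
... | refl , _ = contradiction i≤k (<⇒≱ (n<1+n _))
Inflates-injective (below i≤k _) (above k<i _) eq with ∷-injective eq
... | refl , _ = contradiction
  (≤-trans k<i (≤-trans (m≤m+n _ _) i≤k)) (<⇒≱ (<-trans (n<1+n _) (n<1+n _)))
Inflates-injective at (below i≤k _) eq with ∷-injective eq
... | refl , _ = contradiction i≤k (<⇒≱ (n<1+n _))
Inflates-injective {p} at at eq = cong (_ ∷_) (replicate-++-injective (suc p) eq)
Inflates-injective at (above k<i _) eq with ∷-injective eq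
... | eq′ , _ = contradiction eq′ (<⇒≢ (<-≤-trans k<i (m≤m+n _ _)))
Inflates-injective (above k<i _) (below i≤k _) eq with ∷-injective eq
... | refl , _ = contradiction
  (≤-trans k<i (≤-trans (m≤m+n _ _) i≤k)) (<⇒≱ (<-trans (n<1+n _) (n<1+n _)))
Inflates-injective (above k<i _) at eq with ∷-injective eq
... | eq′ , _ = contradiction (sym eq′) (<⇒≢ (<-≤-trans k<i (m≤m+n _ _)))
Inflates-injective {p} (above _ r) (above _ r′) eq with ∷-injective eq
... | eq₁ , eq₂ = cong₂ _∷_ (+-cancelʳ-≡ p _ _ eq₁) (Inflates-injective r r′ eq₂)

Inflates-length : Inflates p k d c → length c ≡ length d + p
Inflates-length (below _ r) = cong suc (Inflates-length r)
Inflates-length {p} {k} (at {d = d}) = cong suc (trans (length-++ (replicate p k))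
  (trans (cong (_+ length d) (length-replicate p)) (+-comm p _)))
Inflates-length (above _ r) = cong suc (Inflates-length r)

bound-zeros : ∀ n d → bound (replicate n 0 ++ d) ≡ n + bound d
bound-zeros zero    d = refl
bound-zeros (suc n) d = cong suc (bound-zeros n d)

Inflates-bound : Inflates p k d c → bound c ≡ stretch p k (bound d)
Inflates-bound {p} {suc k} {zero ∷ d} (below _ r) =
  trans (cong suc (Inflates-bound r)) (sym (stretch-suc {p} {k} {bound d}))
Inflates-bound {d = suc i ∷ d} (below i≤k r) = sym (stretch-≤ (m≤n⇒m≤1+n i≤k))
Inflates-bound {p} {zero} {zero ∷ d} at =
  trans (bound-zeros (suc p) d) (trans (cong suc (+-comm p (bound d)))
    (sym (stretch-> {0} {suc (bound d)} z<s)))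
Inflates-bound {k = suc k} at = sym (stretch-≤ ≤-refl)
Inflates-bound {d = suc i ∷ d} (above k<i r) = sym (stretch-> k<i)

-- A code that begins with `k` has bound at least `k`, so repeating its first letter is always
-- admissible and a run adds no condition to `Av`.
≤bound-replicate : ∀ n → k ≤ bound (replicate (suc n) k ++ d)
≤bound-replicate {zero}  n = z≤n
≤bound-replicate {suc k} n = ≤-refl

Av-replicate⁺ : ∀ n → Av (k ∷ d) → Av (replicate (suc n) k ++ d)
Av-replicate⁺ zero    av = av
Av-replicate⁺ (suc n) av = ≤bound-replicate n , Av-replicate⁺ n av

Av-replicate⁻ : ∀ n → Av (replicate (suc n) k ++ d) → Av (k ∷ d)
Av-replicate⁻ zero    av       = av
Av-replicate⁻ (suc n) (_ , av) = Av-replicate⁻ n av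

Inflates-Av⁺ : Inflates p k d c → Av d → Av c
Inflates-Av⁺ (below {i = i} i≤k r) (i≤ , av) =
  subst (i ≤_) (sym (Inflates-bound r)) (to (≤-stretch i≤k) i≤) , Inflates-Av⁺ r av
Inflates-Av⁺ {p} at av = Av-replicate⁺ p av
Inflates-Av⁺ (above k<i r) (i≤ , av) =
  subst (_ ≤_) (sym (Inflates-bound r)) (to (+≤-stretch k<i) i≤) , Inflates-Av⁺ r av

Inflates-Av⁻ : Inflates p k d c → Av c → Av d
Inflates-Av⁻ (below {i = i} i≤k r) (i≤ , av) =
  from (≤-stretch i≤k) (subst (i ≤_) (Inflates-bound r) i≤) , Inflates-Av⁻ r av
Inflates-Av⁻ {p} at av = Av-replicate⁻ p av
Inflates-Av⁻ (above k<i r) (i≤ , av) =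
  from (+≤-stretch k<i) (subst (_ ≤_) (Inflates-bound r) i≤) , Inflates-Av⁻ r av

Starts-replicate : ∀ n → Starts k n (replicate n k ++ d)
Starts-replicate zero    = []
Starts-replicate (suc n) = (≤-refl , m≤m+n _ n) ∷ Starts-replicate n

Inflates⇒Cl : Inflates p k d c → Cl (suc p) k c
Inflates⇒Cl (below i≤k r) = below i≤k (Inflates⇒Cl r)
Inflates⇒Cl {p} at        = here (Starts-replicate (suc p))
Inflates⇒Cl {p} {k} (above {i = i} k<i r) =
  above (subst (_≤ i + p) (sym (+-suc k p)) (+-monoˡ-≤ p k<i)) (Inflates⇒Cl r)

-- Direct sums and the dichotomy for clustered codes

-- With an identity as middle summand the code would also be an inflation; `ρ≢id` keeps the two
-- classes disjoint and is the origin of the factor C_l - 1.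
record DirectSum (l k : ℕ) (c : List ℕ) : Set where
  constructor directSum
  field
    α ρ γ : List ℕ
    split : c ≡ α ++ ρ ++ γ
    ∣α∣   : length α ≡ k
    ∣ρ∣   : length ρ ≡ l
    ρ≢id  : ρ ≢ replicate l 0
    avα   : Av α
    avρ   : Av ρ
    avγ   : Av γ

Starts-++ : ∀ ρ β → Valid ρ → Starts 0 (length ρ) (ρ ++ β)
Starts-++ []      β _        = []
Starts-++ (i ∷ ρ) β (i≤ , v) = (z≤n , i≤) ∷ Starts-++ ρ β v

Cl-++ : ∀ α → Valid α → Cl l 0 c → Cl l (length α) (α ++ c)
Cl-++ []      _        cl = cl
Cl-++ (i ∷ α) (i≤ , v) cl = below i≤ (Cl-++ α v cl)

DirectSum⇒Cl : DirectSum l k c → Cl l k c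
DirectSum⇒Cl (directSum α ρ β refl refl refl _ avα avρ _) =
  Cl-++ α (Av⇒Valid α avα) (here (Starts-++ ρ β (Av⇒Valid ρ avρ)))

DirectSum⇒Av : DirectSum l k c → Av c
DirectSum⇒Av (directSum α ρ β refl _ _ _ avα avρ avβ) = Av-++ α avα (Av-++ ρ avρ avβ)

++-injective : ∀ α {α′ β β′ : List ℕ} → length α ≡ length α′ →
  α ++ β ≡ α′ ++ β′ → α ≡ α′ × β ≡ β′
++-injective []      {[]}     _   eq = refl , eq
++-injective (x ∷ α) {y ∷ α′} len eq with ∷-injective eq
... | refl , eq′ with ++-injective α {α′} (suc-injective len) eq′
...   | refl , eq″ = refl , eq″

-- Once the letters below the block are stripped, compare first letters. In a direct sum the first
-- letter is at most the length of the rest of its summand, which a letter `k` or larger violates,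
-- except for a run with `α` empty; there `ρ` would be the identity.
Inflates⇒¬DirectSum : Inflates p k d c → ¬ DirectSum (suc p) k c
Inflates⇒¬DirectSum (below i≤k r) (directSum (_ ∷ α) ρ β refl ∣α∣ ∣ρ∣ ρ≢ (_ , avα) avρ avβ) =
  Inflates⇒¬DirectSum r (directSum α ρ β refl (suc-injective ∣α∣) ∣ρ∣ ρ≢ avα avρ avβ)
Inflates⇒¬DirectSum {p} at (directSum [] ρ β eq refl ∣ρ∣ ρ≢ _ _ _) =
  ρ≢ (sym (proj₁ (++-injective (replicate (suc p) 0)
    (trans (length-replicate (suc p)) (sym ∣ρ∣)) eq)))
Inflates⇒¬DirectSum at (directSum (i ∷ α) ρ β eq refl _ _ (i≤ , avα) _ _) with ∷-injective eq
... | refl , _ = 1+n≰n (≤-trans i≤ (Av⇒bound≤length α avα))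
Inflates⇒¬DirectSum {p} (above k<i _) (directSum [] (j ∷ ρ) β eq refl refl _ _ (j≤ , avρ) _)
  with ∷-injective eq
... | refl , _ = <⇒≱ (m<n+m (length ρ) k<i) (≤-trans j≤ (Av⇒bound≤length ρ avρ))
Inflates⇒¬DirectSum {p} (above k<i _) (directSum (j ∷ α) ρ β eq refl _ _ (j≤ , avα) _ _)
  with ∷-injective eq
... | refl , _ = <⇒≱ (<-≤-trans (<-trans (n<1+n _) k<i) (m≤m+n _ p))
                     (≤-trans j≤ (Av⇒bound≤length α avα))

-- With `k = 0` each letter of the block is at most the number of block letters after it, which is
-- what `≤bound-++` needs to cut the code behind the block.
Starts-0 : Starts 0 l c → Av c →
  ∃₂ λ ρ β → c ≡ ρ ++ β × length ρ ≡ l × Av ρ × Av β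
Starts-0 {c = c} [] av = [] , c , refl , refl , tt , av
Starts-0 ((_ , i≤) ∷ s) (i≤b , av) with Starts-0 s av
... | ρ , β , refl , refl , avρ , avβ =
  _ ∷ ρ , β , refl , refl , (from (≤bound-++ ρ i≤) i≤b , avρ) , avβ

-- Some value smaller than the block lies to its right, so a descent in the block would complete a
-- 321. In letters: each is at least `suc k` and, except for the last, at most the bound of a code
-- that begins with `suc k`, which is `suc k`.
Starts-suc : Starts (suc k) l c → Av c → ∃ λ β → c ≡ replicate l (suc k) ++ β
Starts-suc [] _ = _ , refl
Starts-suc {k} {suc zero} ((k≤ , ≤k) ∷ []) _
  with ≤-antisym k≤ (≤-trans ≤k (≤-reflexive (+-identityʳ _)))
... | refl = _ , refl
Starts-suc {k} {2+ l} ((k≤ , _) ∷ s) (i≤b , av) with Starts-suc s av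
... | β , refl with ≤-antisym k≤ i≤b
...   | refl = β , refl

-- The letters in front of the block are replayed on the decomposition of the rest. A letter below
-- the block extends either form; a letter above it extends only an inflation, since its
-- admissibility over a direct sum would force `ρ` to be the identity.
Cl⇒Inflates⊎DirectSum : Cl (suc p) k c → Av c →
  (∃ λ d → Inflates p k d c) ⊎ DirectSum (suc p) k c
Cl⇒Inflates⊎DirectSum {p} {zero} (here s) av with Starts-0 s av
... | ρ , β , refl , ∣ρ∣ , avρ , avβ with ≡-dec _≟_ ρ (replicate (suc p) 0)
...   | yes refl = inj₁ (0 ∷ β , at)
...   | no ρ≢    = inj₂ (directSum [] ρ β refl refl ∣ρ∣ ρ≢ tt avρ avβ)
Cl⇒Inflates⊎DirectSum {p} {suc k} (here s) av with Starts-suc s av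
... | β , refl = inj₁ (suc k ∷ β , at)
Cl⇒Inflates⊎DirectSum (below i≤k cl) (i≤b , av) with Cl⇒Inflates⊎DirectSum cl av
... | inj₁ (d , r) = inj₁ (_ ∷ d , below i≤k r)
... | inj₂ (directSum α ρ β refl refl ∣ρ∣ ρ≢ avα avρ avβ) = inj₂
  (directSum (_ ∷ α) ρ β refl refl ∣ρ∣ ρ≢ (from (≤bound-++ α i≤k) i≤b , avα) avρ avβ)
Cl⇒Inflates⊎DirectSum {p} {k} (above {i = i} i≥ cl) (i≤b , av) with Cl⇒Inflates⊎DirectSum cl av
-- In the contracted code the run counts as one value, so the letter loses `p`; by `i≥` it stays
-- above `k`.
... | inj₁ (d , r) with i≥′ ← subst (_≤ i) (+-suc k p) i≥ = inj₁ (i ∸ p ∷ d ,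
  subst (λ j → Inflates p k (i ∸ p ∷ d) (j ∷ _)) (m∸n+n≡m (≤-trans (m≤n+m p (suc k)) i≥′))
    (above (m+n≤o⇒m≤o∸n (suc k) i≥′) r))
... | inj₂ (directSum α ρ β refl refl ∣ρ∣ ρ≢ avα avρ avβ) = contradiction ρ≡id ρ≢
  where
  k+l≤b : length α + suc p ≤ bound (α ++ ρ ++ β)
  k+l≤b = ≤-trans i≥ i≤b
  ∣ρ∣≤b⇒id : length ρ ≤ bound ρ → ρ ≡ replicate (suc p) 0
  ∣ρ∣≤b⇒id ≤b = trans (length≤bound⇒identity ρ avρ ≤b) (cong (λ l → replicate l 0) ∣ρ∣)
  ρ≡id : ρ ≡ replicate (suc p) 0
  -- Either the bound is read off inside `α` and is too small for `i`, or `α` contributes its length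
  -- and the remainder must cover all of `ρ`.
  ρ≡id with bound-++ α (ρ ++ β)
  ... | inj₂ eq = contradiction
    (≤-trans k+l≤b (≤-trans (≤-reflexive eq) (Av⇒bound≤length α avα)))
    (<⇒≱ (m<m+n _ z<s))
  ... | inj₁ (_ , _ , eq) with bound-++ ρ β
  ...   | inj₁ (_ , eq′ , _) = ∣ρ∣≤b⇒id (≤-reflexive (sym eq′))
  ...   | inj₂ eq′ = ∣ρ∣≤b⇒id (subst₂ _≤_ (sym ∣ρ∣) eq′
    (+-cancelˡ-≤ (length α) _ _ (subst (_ ≤_) eq k+l≤b)))

-- Enumeration

length-unique : Unique xs → Unique ys → (∀ {z} → (z ∈ xs) ⇔ (z ∈ ys)) → length xs ≡ length ys
length-unique xs! ys! eq = ↭-length (∼bag⇒↭ (unique∧set⇒bag xs! ys! eq))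

map-unique : (f : X → Y) → Unique xs →
  (∀ {x y} → x ∈ xs → y ∈ xs → f x ≡ f y → x ≡ y) → Unique (map f xs)
map-unique f []           inj = []
map-unique f (x∉xs ∷ xs!) inj =
  Allₚ.map⁺ (All.tabulate λ y∈ fx≡fy →
    All.lookup x∉xs y∈ (inj (here refl) (there y∈) fx≡fy)) ∷
  map-unique f xs! (λ x∈ y∈ → inj (there x∈) (there y∈))

concatMap-unique : (g : X → List Y) → (∀ x → Unique (g x)) →
  (∀ {x y z} → z ∈ g x → z ∈ g y → x ≡ y) → Unique xs → Unique (concatMap g xs)
concatMap-unique g g! disj []           = []
concatMap-unique g g! disj (x∉xs ∷ xs!) =
  Uniqueₚ.++⁺ (g! _) (concatMap-unique g g! disj xs!) λ (z∈gx , z∈rest) →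
    let y , y∈xs , z∈gy = find (∈-concatMap⁻ g z∈rest)
    in All.lookup x∉xs y∈xs (disj z∈gx z∈gy)

sum-concatMap : (f : Y → ℕ) (g : X → List Y) (xs : List X) →
  sum (map f (concatMap g xs)) ≡ sum (map (λ x → sum (map f (g x))) xs)
sum-concatMap f g []       = refl
sum-concatMap f g (x ∷ xs) = begin
  sum (map f (g x ++ concatMap g xs))
    ≡⟨ cong sum (map-++ f (g x) _) ⟩
  sum (map f (g x) ++ map f (concatMap g xs))
    ≡⟨ sum-++ (map f (g x)) _ ⟩
  sum (map f (g x)) + sum (map f (concatMap g xs))
    ≡⟨ cong (sum (map f (g x)) +_) (sum-concatMap f g xs) ⟩
  sum (map f (g x)) + sum (map (λ x → sum (map f (g x))) xs) ∎
  where open ≡-Reasoning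

-- The generating tree of codes

prepend : List ℕ → List (List ℕ)
prepend c = map (_∷ c) (upTo (suc (bound c)))

avs : ℕ → List (List ℕ)
avs zero    = [] ∷ []
avs (suc n) = concatMap prepend (avs n)

∈-avs⁺ : ∀ {n} c → Av c → length c ≡ n → c ∈ avs n
∈-avs⁺ []      _         refl = here refl
∈-avs⁺ (i ∷ c) (i≤ , av) refl = ∈-concatMap⁺ prepend
  (lose (∈-avs⁺ c av refl) (∈-map⁺ (_∷ c) (∈-upTo⁺ (s≤s i≤))))

∈-avs⁻ : ∀ n {c} → c ∈ avs n → Av c × length c ≡ n
∈-avs⁻ zero    (here refl) = tt , refl
∈-avs⁻ (suc n) c∈ with find (∈-concatMap⁻ prepend {xs = avs n} c∈)
... | c , c∈avs , c∈pre with ∈-map⁻ (_∷ c) c∈pre | ∈-avs⁻ n c∈avs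
...   | i , i∈ , refl | av , refl = (s≤s⁻¹ (∈-upTo⁻ i∈) , av) , refl

prepend-disjoint : ∀ {c c′ d} → d ∈ prepend c → d ∈ prepend c′ → c ≡ c′
prepend-disjoint p q with ∈-map⁻ _ p | ∈-map⁻ _ q
... | _ , _ , refl | _ , _ , eq = ∷-injectiveʳ eq

avs-unique : ∀ n → Unique (avs n)
avs-unique zero    = [] ∷ []
avs-unique (suc n) = concatMap-unique prepend
  (λ c → Uniqueₚ.map⁺ ∷-injectiveˡ (Uniqueₚ.upTo⁺ _)) prepend-disjoint (avs-unique n)

-- The bounds of the codes obtained by prepending one letter: 0 raises the bound
-- by one, and i > 0 makes it i.
children : ℕ → List ℕ
children b = suc b ∷ applyUpTo suc b

descendants : ℕ → ℕ → ℕ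
descendants zero    b = 1
descendants (suc n) b = sum (map (descendants n) (children b))

bound-prepend : ∀ c → map bound (prepend c) ≡ children (bound c)
bound-prepend c = cong (suc (bound c) ∷_)
  (trans (cong (map bound) (map-applyUpTo suc (_∷ c) (bound c)))
         (map-applyUpTo (λ i → suc i ∷ c) bound (bound c)))

-- Stated for all `k`, so that the induction can trade a level of the tree for a level of
-- descendants; `k = 0` then counts level `n`.
sum-descendants : ∀ n k → sum (map (descendants k ∘ bound) (avs n)) ≡ descendants (n + k) 0
sum-descendants zero    k = +-identityʳ _
sum-descendants (suc n) k = begin
  sum (map (descendants k ∘ bound) (concatMap prepend (avs n)))
    ≡⟨ sum-concatMap (descendants k ∘ bound) prepend (avs n) ⟩
  sum (map (λ c → sum (map (descendants k ∘ bound) (prepend c))) (avs n))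
    ≡⟨ cong sum (map-cong (λ c → cong sum
         (trans (map-∘ (prepend c)) (cong (map (descendants k)) (bound-prepend c)))) (avs n)) ⟩
  sum (map (descendants (suc k) ∘ bound) (avs n))
    ≡⟨ sum-descendants n (suc k) ⟩
  descendants (n + suc k) 0
    ≡⟨ cong (λ m → descendants m 0) (+-suc n k) ⟩
  descendants (suc n + k) 0 ∎
  where open ≡-Reasoning

sum-ones : (xs : List X) → sum (map (λ _ → 1) xs) ≡ length xs
sum-ones []       = refl
sum-ones (_ ∷ xs) = cong suc (sum-ones xs)

length-avs : ∀ n → length (avs n) ≡ descendants n 0
length-avs n = trans (sym (sum-ones (avs n)))
  (trans (sum-descendants n 0) (cong (λ m → descendants m 0) (+-identityʳ n)))

-- A node of bound `suc b` has children of the same bounds as a node of bound `b`, and one more, of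
-- bound `2 + b`.
descendants-suc : ∀ n b → descendants (suc n) (suc b) ≡ descendants (suc n) b + descendants n (2 + b)
descendants-suc n b = begin
  f (2 + b) + sum (map f (applyUpTo suc (suc b)))
    ≡⟨ cong (λ ys → f (2 + b) + sum (map f ys)) (applyUpTo-∷ʳ suc b) ⟨
  f (2 + b) + sum (map f (applyUpTo suc b ++ suc b ∷ []))
    ≡⟨ cong (λ ys → f (2 + b) + sum ys) (map-++ f (applyUpTo suc b) _) ⟩
  f (2 + b) + sum (map f (applyUpTo suc b) ++ f (suc b) ∷ [])
    ≡⟨ cong (f (2 + b) +_) (sum-++ (map f (applyUpTo suc b)) _) ⟩
  f (2 + b) + (sum (map f (applyUpTo suc b)) + (f (suc b) + 0))
    ≡⟨ rearrange (f (2 + b)) _ (f (suc b)) ⟩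
  f (suc b) + sum (map f (applyUpTo suc b)) + f (2 + b) ∎
  where
  open ≡-Reasoning
  f = descendants n
  rearrange : ∀ x y z → x + (y + (z + 0)) ≡ z + y + x
  rearrange = solve-∀

-- Ballot numbers and Catalan numbers

-- The coefficient at `n - 1` has to vanish for `n = 0`, where truncated subtraction would give 1.
_Cpred_ : ℕ → ℕ → ℕ
N Cpred zero  = 0
N Cpred suc n = N C n

pascal : ∀ N n → N Cpred n + N C n ≡ suc N C n
pascal N zero    = refl
pascal N (suc n) = nCk+nC[k+1]≡[n+1]C[k+1] N n

central-symmetry : ∀ n → (1 + 2 * n) C suc n ≡ (1 + 2 * n) C n
central-symmetry n = trans
  (nCk≡nC[n∸k] {n = 1 + 2 * n} (s≤s (m≤m+n n _)))
  (cong ((1 + 2 * n) C_) (trans (m+n∸m≡n n (n + 0)) (+-identityʳ n)))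

-- The ballot number as a difference of neighbouring binomial coefficients, written as a sum. The
-- step in `b` is `descendants-suc` with Pascal's rule applied twice; at `b = 0` the only child has
-- bound 1, and the symmetry of row `2n + 1` closes the gap.
ballot : ∀ n b → descendants n b + (2 * n + b) Cpred n ≡ (2 * n + b) C n
ballot zero    b       = refl
ballot (suc n) zero    = begin
  descendants n 1 + 0 + (2 * suc n + 0) C n
    ≡⟨ cong₂ _+_ (+-identityʳ _) (cong (_C n) (2*suc n)) ⟩
  descendants n 1 + suc M C n
    ≡⟨ cong (descendants n 1 +_) (pascal M n) ⟨
  descendants n 1 + (M Cpred n + M C n)
    ≡⟨ +-assoc (descendants n 1) _ _ ⟨
  descendants n 1 + M Cpred n + M C n
    ≡⟨ cong (_+ M C n) (subst (λ N → descendants n 1 + N Cpred n ≡ N C n)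
         (+-comm (2 * n) 1) (ballot n 1)) ⟩
  M C n + M C n
    ≡⟨ cong (M C n +_) (central-symmetry n) ⟨
  M C n + M C suc n
    ≡⟨ pascal M (suc n) ⟩
  suc M C suc n
    ≡⟨ cong (_C suc n) (2*suc n) ⟨
  (2 * suc n + 0) C suc n ∎
  where
  open ≡-Reasoning
  M = 1 + 2 * n
  2*suc : ∀ n → 2 * suc n + 0 ≡ suc (1 + 2 * n)
  2*suc = solve-∀
ballot (suc n) (suc b) = begin
  descendants (suc n) (suc b) + (2 * suc n + suc b) C n
    ≡⟨ cong₂ _+_ (descendants-suc n b) (cong (_C n) (+-suc (2 * suc n) b)) ⟩
  D + E + suc M C n
    ≡⟨ cong (D + E +_) (pascal M n) ⟨
  D + E + (M Cpred n + M C n)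
    ≡⟨ rearrange D E _ _ ⟩
  E + M Cpred n + (D + M C n)
    ≡⟨ cong₂ _+_ (subst (λ N → E + N Cpred n ≡ N C n) (N≡M n b) (ballot n (2 + b)))
                 (ballot (suc n) b) ⟩
  M C n + M C suc n
    ≡⟨ pascal M (suc n) ⟩
  suc M C suc n
    ≡⟨ cong (_C suc n) (+-suc (2 * suc n) b) ⟨
  (2 * suc n + suc b) C suc n ∎
  where
  open ≡-Reasoning
  M = 2 * suc n + b
  D = descendants (suc n) b
  E = descendants n (2 + b)
  N≡M : ∀ n b → 2 * n + (2 + b) ≡ 2 * suc n + b
  N≡M = solve-∀
  rearrange : ∀ w x y z → w + x + (y + z) ≡ x + y + (w + z)
  rearrange = solve-∀

absorption : ∀ N k → suc k * (suc N C suc k) ≡ suc N * (N C k)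
absorption zero    zero    = refl
absorption zero    (suc k) = *-zeroʳ k
absorption (suc N) zero    = trans (+-identityʳ _) (trans (nC1≡n (2 + N)) (sym (*-identityʳ _)))
absorption (suc N) (suc k) = begin
  (2 + k) * ((2 + N) C (2 + k))
    ≡⟨ cong ((2 + k) *_) (nCk+nC[k+1]≡[n+1]C[k+1] (suc N) (suc k)) ⟨
  (2 + k) * (a + suc N C (2 + k))
    ≡⟨ expand k a _ ⟩
  a + (suc k * a + (2 + k) * (suc N C (2 + k)))
    ≡⟨ cong (a +_) (cong₂ _+_ (absorption N k) (absorption N (suc k))) ⟩
  a + (suc N * (N C k) + suc N * (N C suc k))
    ≡⟨ cong (a +_) (*-distribˡ-+ (suc N) (N C k) _) ⟨
  a + suc N * (N C k + N C suc k)
    ≡⟨ cong (λ z → a + suc N * z) (nCk+nC[k+1]≡[n+1]C[k+1] N k) ⟩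
  (2 + N) * a ∎
  where
  open ≡-Reasoning
  a = suc N C suc k
  expand : ∀ k a b → (2 + k) * (a + b) ≡ a + (suc k * a + (2 + k) * b)
  expand = solve-∀

central-Cpred : ∀ n → n * ((2 * n) C n) ≡ suc n * ((2 * n) Cpred n)
central-Cpred zero    = refl
-- The added term completes `N C suc n` to `suc N C suc n`, to which `absorption` applies.
central-Cpred (suc n) = +-cancelˡ-≡ (suc n * (N C n)) _ _ (begin
  suc n * (N C n) + suc n * (N C suc n)
    ≡⟨ *-distribˡ-+ (suc n) (N C n) _ ⟨
  suc n * (N C n + N C suc n)
    ≡⟨ cong (suc n *_) (nCk+nC[k+1]≡[n+1]C[k+1] N n) ⟩
  suc n * (suc N C suc n)
    ≡⟨ absorption N n ⟩
  suc N * (N C n)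
    ≡⟨ collect n (N C n) ⟩
  suc n * (N C n) + (2 + n) * (N C n) ∎)
  where
  open ≡-Reasoning
  N = 2 * suc n
  collect : ∀ n a → suc (2 * suc n) * a ≡ suc n * a + (2 + n) * a
  collect = solve-∀

suc*length-avs : ∀ n → suc n * length (avs n) ≡ (2 * n) C n
suc*length-avs n = +-cancelʳ-≡ (suc n * ((2 * n) Cpred n)) _ _ (begin
  suc n * length (avs n) + suc n * ((2 * n) Cpred n)
    ≡⟨ *-distribˡ-+ (suc n) (length (avs n)) _ ⟨
  suc n * (length (avs n) + (2 * n) Cpred n)
    ≡⟨ cong (suc n *_) (trans (cong (_+ (2 * n) Cpred n) (length-avs n))
         (subst (λ N → descendants n 0 + N Cpred n ≡ N C n) (+-identityʳ (2 * n)) (ballot n 0))) ⟩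
  (2 * n) C n + n * ((2 * n) C n)
    ≡⟨ cong ((2 * n) C n +_) (central-Cpred n) ⟩
  (2 * n) C n + suc n * ((2 * n) Cpred n) ∎)
  where open ≡-Reasoning

-- The list of clustered avoiders and its length

identity : ℕ → List ℕ
identity n = replicate n 0

nonIdentities : ℕ → List (List ℕ)
nonIdentities n = filter (λ c → ¬? (≡-dec _≟_ c (identity n))) (avs n)

Av-identity : ∀ n → Av (identity n)
Av-identity zero    = tt
Av-identity (suc n) = z≤n , Av-identity n

length-nonIdentities : ∀ n → length (avs n) ≡ suc (length (nonIdentities n))
length-nonIdentities n = length-unique (avs-unique n)
  (All.tabulate (λ c∈ id≡c → proj₂ (∈-filter⁻ _ {xs = avs n} c∈) (sym id≡c))
    ∷ Uniqueₚ.filter⁺ _ (avs-unique n))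
  (mk⇔ to′ from′)
  where
  to′ : ∀ {c} → c ∈ avs n → c ∈ identity n ∷ nonIdentities n
  to′ {c} c∈ with ≡-dec _≟_ c (identity n)
  ... | yes eq = here eq
  ... | no  ≢  = there (∈-filter⁺ _ c∈ ≢)
  from′ : ∀ {c} → c ∈ identity n ∷ nonIdentities n → c ∈ avs n
  from′ (here refl) = ∈-avs⁺ _ (Av-identity n) (length-replicate n)
  from′ (there c∈)  = proj₁ (∈-filter⁻ _ {xs = avs n} c∈)

length-cartesianProduct : (xs : List X) (ys : List Y) →
  length (cartesianProduct xs ys) ≡ length xs * length ys
length-cartesianProduct []       ys = refl
length-cartesianProduct (x ∷ xs) ys = trans (length-++ (map (x ,_) ys))
  (cong₂ _+_ (length-map (x ,_) ys) (length-cartesianProduct xs ys))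

juxtapose : List ℕ × List ℕ × List ℕ → List ℕ
juxtapose (α , ρ , γ) = α ++ ρ ++ γ

inflations directSums clusteredAvs : ℕ → ℕ → ℕ → List (List ℕ)
inflations   p k r = map (inflate p k) (avs (suc k + r))
directSums   p k r = map juxtapose
  (cartesianProduct (avs k) (cartesianProduct (nonIdentities (suc p)) (avs r)))
clusteredAvs p k r = inflations p k r ++ directSums p k r

module _ (p k r : ℕ) where

  ∈-inflations⁺ : ∀ {c d} → Inflates p k d c → Av c → length c ≡ suc k + r + p →
    c ∈ inflations p k r
  ∈-inflations⁺ {d = d} inf av len with Inflates⇒≡ inf
  ... | refl = ∈-map⁺ (inflate p k) (∈-avs⁺ d (Inflates-Av⁻ inf av)
    (+-cancelʳ-≡ p _ _ (trans (sym (Inflates-length inf)) len)))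

  avs-inflates : ∀ {d} → d ∈ avs (suc k + r) → Inflates p k d (inflate p k d)
  avs-inflates {d} d∈ with ∈-avs⁻ (suc k + r) d∈
  ... | av , len = inflates p k d (Av⇒Valid d av)
    (subst (k <_) (sym len) (s≤s (m≤m+n k r)))

  ∈-inflations⁻ : ∀ {c} → c ∈ inflations p k r →
    Av c × length c ≡ suc k + r + p × ∃ λ d → Inflates p k d c
  ∈-inflations⁻ c∈ with ∈-map⁻ (inflate p k) c∈
  ... | d , d∈ , refl with avs-inflates d∈ | ∈-avs⁻ (suc k + r) d∈
  ...   | inf | av , len =
    Inflates-Av⁺ inf av , trans (Inflates-length inf) (cong (_+ p) len) , d , inf

  triple⁻ : ∀ {α ρ γ} →
    (α , ρ , γ) ∈ cartesianProduct (avs k) (cartesianProduct (nonIdentities (suc p)) (avs r)) →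
    (Av α × length α ≡ k) × (Av ρ × length ρ ≡ suc p) × ρ ≢ identity (suc p) ×
    (Av γ × length γ ≡ r)
  triple⁻ t∈ with ∈-cartesianProduct⁻ (avs k) _ t∈
  ... | α∈ , ργ∈ with ∈-cartesianProduct⁻ (nonIdentities (suc p)) (avs r) ργ∈
  ...   | ρ∈ , γ∈ with ∈-filter⁻ _ {xs = avs (suc p)} ρ∈
  ...     | ρ∈avs , ρ≢ = ∈-avs⁻ k α∈ , ∈-avs⁻ (suc p) ρ∈avs , ρ≢ , ∈-avs⁻ r γ∈

  length-juxtapose : ∀ (α ρ : List ℕ) {γ : List ℕ} → length α ≡ k → length ρ ≡ suc p →
    length (α ++ ρ ++ γ) ≡ k + suc p + length γ
  length-juxtapose α ρ refl eq = trans (length-++ α)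
    (trans (cong (k +_) (trans (length-++ ρ) (cong (_+ _) eq))) (sym (+-assoc k (suc p) _)))

  total : k + suc p + r ≡ suc k + r + p
  total = lemma k p r
    where
    lemma : ∀ k p r → k + suc p + r ≡ suc k + r + p
    lemma = solve-∀

  ∈-directSums⁺ : ∀ {c} → DirectSum (suc p) k c → length c ≡ suc k + r + p →
    c ∈ directSums p k r
  ∈-directSums⁺ (directSum α ρ γ refl ∣α∣ ∣ρ∣ ρ≢ avα avρ avγ) len = ∈-map⁺ juxtapose
    (∈-cartesianProduct⁺ (∈-avs⁺ α avα ∣α∣) (∈-cartesianProduct⁺
      (∈-filter⁺ _ (∈-avs⁺ ρ avρ ∣ρ∣) ρ≢) (∈-avs⁺ γ avγ ∣γ∣)))
    where
    ∣γ∣ : length γ ≡ r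
    ∣γ∣ = +-cancelˡ-≡ (k + suc p) _ _
      (trans (sym (length-juxtapose α ρ ∣α∣ ∣ρ∣)) (trans len (sym total)))

  ∈-directSums⁻ : ∀ {c} → c ∈ directSums p k r →
    length c ≡ suc k + r + p × DirectSum (suc p) k c
  ∈-directSums⁻ c∈ with ∈-map⁻ juxtapose c∈
  ... | (α , ρ , γ) , t∈ , refl with triple⁻ t∈
  ...   | (avα , ∣α∣) , (avρ , ∣ρ∣) , ρ≢ , (avγ , ∣γ∣) =
    trans (length-juxtapose α ρ ∣α∣ ∣ρ∣) (trans (cong (k + suc p +_) ∣γ∣) total) ,
    directSum α ρ γ refl ∣α∣ ∣ρ∣ ρ≢ avα avρ avγ

  ∈-clusteredAvs⁺ : ∀ {c} → Av c → Cl (suc p) k c → length c ≡ suc k + r + p →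
    c ∈ clusteredAvs p k r
  ∈-clusteredAvs⁺ av cl len with Cl⇒Inflates⊎DirectSum cl av
  ... | inj₁ (_ , inf) = ∈-++⁺ˡ (∈-inflations⁺ inf av len)
  ... | inj₂ ds        = ∈-++⁺ʳ (inflations p k r) (∈-directSums⁺ ds len)

  ∈-clusteredAvs⁻ : ∀ {c} → c ∈ clusteredAvs p k r →
    Av c × Cl (suc p) k c × length c ≡ suc k + r + p
  ∈-clusteredAvs⁻ c∈ with ∈-++⁻ (inflations p k r) c∈
  ... | inj₁ c∈inf with ∈-inflations⁻ c∈inf
  ...   | av , len , _ , inf = av , Inflates⇒Cl inf , len
  ∈-clusteredAvs⁻ c∈ | inj₂ c∈ds with ∈-directSums⁻ c∈ds
  ...   | len , ds = DirectSum⇒Av ds , DirectSum⇒Cl ds , len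

  clusteredAvs-unique : Unique (clusteredAvs p k r)
  clusteredAvs-unique = Uniqueₚ.++⁺
    (map-unique (inflate p k) (avs-unique (suc k + r))
      λ x∈ y∈ → Inflates-injective (avs-inflates x∈) (avs-inflates y∈))
    (map-unique juxtapose
      (Uniqueₚ.cartesianProduct⁺ (avs-unique k)
        (Uniqueₚ.cartesianProduct⁺ (Uniqueₚ.filter⁺ _ (avs-unique (suc p))) (avs-unique r)))
      juxtapose-injective)
    λ (c∈inf , c∈ds) → let _ , _ , _ , inf = ∈-inflations⁻ c∈inf
                       in Inflates⇒¬DirectSum inf (proj₂ (∈-directSums⁻ c∈ds))
    where
    juxtapose-injective : ∀ {t t′} →
      t ∈ cartesianProduct (avs k) (cartesianProduct (nonIdentities (suc p)) (avs r)) →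
      t′ ∈ cartesianProduct (avs k) (cartesianProduct (nonIdentities (suc p)) (avs r)) →
      juxtapose t ≡ juxtapose t′ → t ≡ t′
    juxtapose-injective {α , ρ , γ} {α′ , ρ′ , γ′} t∈ t′∈ eq with triple⁻ t∈ | triple⁻ t′∈
    ... | (_ , ∣α∣) , (_ , ∣ρ∣) , _ | (_ , ∣α′∣) , (_ , ∣ρ′∣) , _
      with ++-injective α {α′} (trans ∣α∣ (sym ∣α′∣)) eq
    ...   | refl , eq′ with ++-injective ρ {ρ′} (trans ∣ρ∣ (sym ∣ρ′∣)) eq′
    ...     | refl , refl = refl

  length-clusteredAvs : length (clusteredAvs p k r) ≡
    length (avs (suc k + r)) + length (avs k) * (length (nonIdentities (suc p)) * length (avs r))
  length-clusteredAvs = trans (length-++ (inflations p k r)) (cong₂ _+_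
    (length-map (inflate p k) (avs (suc k + r)))
    (trans (length-map juxtapose (cartesianProduct (avs k) _))
      (trans (length-cartesianProduct (avs k) _)
        (cong (length (avs k) *_) (length-cartesianProduct (nonIdentities (suc p)) (avs r))))))

-- Codes of permutations

code : Permutation′ n → List ℕ
code {zero}  σ = []
code {suc n} σ = toℕ (σ ⟨$⟩ʳ zero) ∷ code (remove zero σ)

length-code : (σ : Permutation′ n) → length (code σ) ≡ n
length-code {zero}  σ = refl
length-code {suc n} σ = cong suc (length-code (remove zero σ))

code-Valid : (σ : Permutation′ n) → Valid (code σ)
code-Valid {zero}  σ = tt
code-Valid {suc n} σ =
  subst (toℕ (σ ⟨$⟩ʳ zero) ≤_) (sym (length-code (remove zero σ)))
    (s≤s⁻¹ (Finₚ.toℕ<n (σ ⟨$⟩ʳ zero))) ,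
  code-Valid (remove zero σ)

toℕ-punchIn : (i : Fin (suc n)) (j : Fin n) → toℕ (punchIn i j) ≡ pin (toℕ i) (toℕ j)
toℕ-punchIn zero    j       = refl
toℕ-punchIn (suc i) zero    = refl
toℕ-punchIn (suc i) (suc j) = cong suc (toℕ-punchIn i j)

val-code : (σ : Permutation′ n) (j : Fin n) → val (code σ) (toℕ j) ≡ toℕ (σ ⟨$⟩ʳ j)
val-code σ zero    = refl
val-code σ (suc j) = begin
  pin (toℕ (σ ⟨$⟩ʳ zero)) (val (code (remove zero σ)) (toℕ j))
    ≡⟨ cong (pin _) (val-code (remove zero σ) j) ⟩
  pin (toℕ (σ ⟨$⟩ʳ zero)) (toℕ (remove zero σ ⟨$⟩ʳ j))
    ≡⟨ toℕ-punchIn (σ ⟨$⟩ʳ zero) _ ⟨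
  toℕ (punchIn (σ ⟨$⟩ʳ zero) (remove zero σ ⟨$⟩ʳ j))
    ≡⟨ cong toℕ (insert-remove zero σ (suc j)) ⟩
  toℕ (σ ⟨$⟩ʳ suc j) ∎
  where open ≡-Reasoning

code-injective : (σ ρ : Permutation′ n) → code σ ≡ code ρ → σ ≈ ρ
code-injective σ ρ eq j = Finₚ.toℕ-injective
  (trans (sym (val-code σ j)) (trans (cong (λ c → val c (toℕ j)) eq) (val-code ρ j)))

code-cong : (σ ρ : Permutation′ n) → σ ≈ ρ → code σ ≡ code ρ
code-cong {zero}  σ ρ eq = refl
code-cong {suc n} σ ρ eq = cong₂ _∷_ (cong toℕ (eq zero))
  (code-cong (remove zero σ) (remove zero ρ) λ j →
    Finₚ.punchIn-injective (σ ⟨$⟩ʳ zero) _ _ (begin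
      punchIn (σ ⟨$⟩ʳ zero) (remove zero σ ⟨$⟩ʳ j) ≡⟨ insert-remove zero σ (suc j) ⟩
      σ ⟨$⟩ʳ suc j                                  ≡⟨ eq (suc j) ⟩
      ρ ⟨$⟩ʳ suc j                                  ≡⟨ insert-remove zero ρ (suc j) ⟨
      punchIn (ρ ⟨$⟩ʳ zero) (remove zero ρ ⟨$⟩ʳ j)
        ≡⟨ cong (λ i → punchIn i (remove zero ρ ⟨$⟩ʳ j)) (eq zero) ⟨
      punchIn (σ ⟨$⟩ʳ zero) (remove zero ρ ⟨$⟩ʳ j) ∎))
  where open ≡-Reasoning

decode : ∀ c → Valid c → length c ≡ n → ∃ λ (σ : Permutation′ n) → code σ ≡ c
decode []      _        refl = id , refl
decode (i ∷ c) (i≤ , v) refl with decode c v refl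
... | π , eq = insert zero (fromℕ< (s≤s i≤)) π , cong₂ _∷_ (Finₚ.toℕ-fromℕ< (s≤s i≤))
  (trans (code-cong _ π (remove-insert zero (fromℕ< (s≤s i≤)) π)) eq)

-- Rearranging the positions by a fixed `ω` first lets both patterns be counted against the same
-- list of codes.
∣∣≡length : (ω : Permutation′ n) {P : Pred (Permutation′ n) 0ℓ} (P? : Decidable P)
  {cs : List (List ℕ)} → Unique cs → (∀ {c} → c ∈ cs → Valid c × length c ≡ n) →
  (∀ σ → P σ ⇔ (code (ω ∘ₚ σ) ∈ cs)) → ∣ P? ∣ ≡ length cs
∣∣≡length {n} ω {P} P? {cs} cs! valid iff = trans
  (sym (length-map encode (filter P? (permutations n))))
  (length-unique codes! cs! (mk⇔ to′ from′))
  where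
  encode : Permutation′ n → List ℕ
  encode σ = code (ω ∘ₚ σ)
  encode-injective : ∀ {σ ρ} → encode σ ≡ encode ρ → σ ≈ ρ
  encode-injective {σ} {ρ} eq i = subst (λ j → σ ⟨$⟩ʳ j ≡ ρ ⟨$⟩ʳ j) (inverseʳ ω)
    (code-injective (ω ∘ₚ σ) (ω ∘ₚ ρ) eq (flip ω ⟨$⟩ʳ i))
  codes! : Unique (map encode (filter P? (permutations n)))
  codes! = Uniqueₛ.map⁺ (permutationSetoid n) (setoid _) (λ {σ} {ρ} → encode-injective {σ} {ρ})
    (Uniqueₛ.filter⁺ (permutationSetoid n) P? (permutations-unique n))
  to′ : ∀ {c} → c ∈ map encode (filter P? (permutations n)) → c ∈ cs
  to′ c∈ with ∈-map⁻ encode c∈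
  ... | σ , σ∈ , refl = to (iff σ) (proj₂ (∈-filter⁻ P? {xs = permutations n} σ∈))
  from′ : ∀ {c} → c ∈ cs → c ∈ map encode (filter P? (permutations n))
  from′ {c} c∈ with valid c∈
  ... | v , len with decode c v len
  -- `flip ω` undoes the rearrangement; the enumeration provides only some `σ` pointwise equal to
  -- the result.
  ...   | π , refl with find (permutations-complete n (flip ω ∘ₚ π))
  ...     | σ , σ∈ , eq = subst (_∈ map encode _) encode-σ
    (∈-map⁺ encode (∈-filter⁺ P? σ∈ (from (iff σ) (subst (_∈ cs) (sym encode-σ) c∈))))
    where
    encode-σ : encode σ ≡ code π
    encode-σ = code-cong (ω ∘ₚ σ) π λ i →
      trans (sym (eq (ω ⟨$⟩ʳ i))) (cong (π ⟨$⟩ʳ_) (inverseˡ ω))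

-- Patterns, blocks and reversal

StrictlyDecreasing : (Fin m → Fin n) → Set
StrictlyDecreasing f = ∀ {i j} → i Fin.< j → f j Fin.< f i

decreasing-⇔ : ∀ {n′} {f : Fin m → Fin n} {g : Fin m → Fin n′} →
  StrictlyDecreasing f → StrictlyDecreasing g →
  ∀ i j → (f i Fin.< f j) ⇔ (g i Fin.< g j)
decreasing-⇔ {f = f} {g} f↓ g↓ i j with Finₚ.<-cmp i j
... | tri< i<j _ _  = mk⇔ (λ p → contradiction (f↓ i<j) (<-asym p))
                          (λ p → contradiction (g↓ i<j) (<-asym p))
... | tri≈ _ refl _ = mk⇔ (λ p → contradiction p (<-irrefl refl))
                          (λ p → contradiction p (<-irrefl refl))
... | tri> _ _ j<i  = mk⇔ (λ _ → g↓ j<i) (λ _ → f↓ j<i)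

module _ (τ : Permutation′ 3) (τ≈321 : τ ≈ τ₃₂₁) (σ : Permutation′ n) where

  τ-decreasing : StrictlyDecreasing (τ ⟨$⟩ʳ_)
  τ-decreasing {i} {j} i<j =
    subst₂ Fin._<_ (sym (τ≈321 j)) (sym (τ≈321 i)) (opposite-anti i<j)

  Avoids⇒No321 : Avoids τ σ → No321 (code σ)
  Avoids⇒No321 avoids {i} {j} {h} i<j j<h h<∣c∣ vj<vi vh<vj =
    avoids (ι , ι-mono , decreasing-⇔ {g = τ ⟨$⟩ʳ_} σι-decreasing τ-decreasing)
    where
    h<n = subst (h <_) (length-code σ) h<∣c∣
    j<n = <-trans j<h h<n
    i<n = <-trans i<j j<n
    ι : Fin 3 → Fin n
    ι 0F = fromℕ< i<n
    ι 1F = fromℕ< j<n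
    ι 2F = fromℕ< h<n
    at-fromℕ< : ∀ {x y} (x<n : x < n) (y<n : y < n) → val (code σ) x < val (code σ) y →
      σ ⟨$⟩ʳ fromℕ< x<n Fin.< σ ⟨$⟩ʳ fromℕ< y<n
    at-fromℕ< x<n y<n = subst₂ _<_
      (trans (cong (val (code σ)) (sym (Finₚ.toℕ-fromℕ< x<n))) (val-code σ _))
      (trans (cong (val (code σ)) (sym (Finₚ.toℕ-fromℕ< y<n))) (val-code σ _))
    fromℕ<-mono : ∀ {x y} (x<n : x < n) (y<n : y < n) → x < y → fromℕ< x<n Fin.< fromℕ< y<n
    fromℕ<-mono x<n y<n = subst₂ _<_ (sym (Finₚ.toℕ-fromℕ< x<n)) (sym (Finₚ.toℕ-fromℕ< y<n))
    ι-mono : ∀ {a b} → a Fin.< b → ι a Fin.< ι b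
    ι-mono {0F} {1F} _ = fromℕ<-mono i<n j<n i<j
    ι-mono {0F} {2F} _ = fromℕ<-mono i<n h<n (<-trans i<j j<h)
    ι-mono {1F} {2F} _ = fromℕ<-mono j<n h<n j<h
    ι-mono {1F} {1F} (s≤s ())
    ι-mono {2F} {1F} (s≤s ())
    ι-mono {2F} {2F} (s≤s (s≤s ()))
    σι-decreasing : StrictlyDecreasing (λ a → σ ⟨$⟩ʳ ι a)
    σι-decreasing {0F} {1F} _ = at-fromℕ< j<n i<n vj<vi
    σι-decreasing {0F} {2F} _ = at-fromℕ< h<n i<n (<-trans vh<vj vj<vi)
    σι-decreasing {1F} {2F} _ = at-fromℕ< h<n j<n vh<vj
    σι-decreasing {1F} {1F} (s≤s ())
    σι-decreasing {2F} {1F} (s≤s ())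
    σι-decreasing {2F} {2F} (s≤s (s≤s ()))

  No321⇒Avoids : No321 (code σ) → Avoids τ σ
  No321⇒Avoids no321 (ι , ι-mono , iso) = no321
    (ι-mono {0F} {1F} z<s) (ι-mono {1F} {2F} (s<s z<s))
    (subst (toℕ (ι 2F) <_) (sym (length-code σ)) (Finₚ.toℕ<n (ι 2F)))
    (decreases {0F} {1F} z<s) (decreases {1F} {2F} (s<s z<s))
    where
    decreases : ∀ {a b} → a Fin.< b → val (code σ) (toℕ (ι b)) < val (code σ) (toℕ (ι a))
    decreases {a} {b} a<b = subst₂ _<_ (sym (val-code σ (ι b))) (sym (val-code σ (ι a)))
      (from (iso b a) (τ-decreasing a<b))

  Avoids⇔Av : Avoids τ σ ⇔ Av (code σ)
  Avoids⇔Av = mk⇔ (No321⇒Av (code σ) (code-Valid σ) ∘ Avoids⇒No321)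
                  (No321⇒Avoids ∘ Av⇒No321 (code σ))

module _ (τ : Permutation′ m) (σ : Permutation′ n) where

  Contains-reverse⁺ : Contains τ σ → Contains (reverse ∘ₚ τ) (reverse ∘ₚ σ)
  Contains-reverse⁺ (ι , ι-mono , iso) =
    opposite ∘ ι ∘ opposite ,
    (λ a<b → opposite-anti (ι-mono (opposite-anti a<b))) ,
    λ a b → subst₂
      (λ x y → (σ ⟨$⟩ʳ x Fin.< σ ⟨$⟩ʳ y) ⇔
               (τ ⟨$⟩ʳ opposite a Fin.< τ ⟨$⟩ʳ opposite b))
      (sym (Finₚ.opposite-involutive _)) (sym (Finₚ.opposite-involutive _))
      (iso (opposite a) (opposite b))

  Contains-reverse⁻ : Contains (reverse ∘ₚ τ) (reverse ∘ₚ σ) → Contains τ σ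
  Contains-reverse⁻ (ι , ι-mono , iso) =
    opposite ∘ ι ∘ opposite ,
    (λ a<b → opposite-anti (ι-mono (opposite-anti a<b))) ,
    λ a b → subst₂
      (λ x y → (σ ⟨$⟩ʳ opposite (ι (opposite a)) Fin.< σ ⟨$⟩ʳ opposite (ι (opposite b))) ⇔
               (τ ⟨$⟩ʳ x Fin.< τ ⟨$⟩ʳ y))
      (Finₚ.opposite-involutive a) (Finₚ.opposite-involutive b) (iso (opposite a) (opposite b))

  Avoids-reverse : Avoids τ σ ⇔ Avoids (reverse ∘ₚ τ) (reverse ∘ₚ σ)
  Avoids-reverse = mk⇔ (_∘ Contains-reverse⁻) (_∘ Contains-reverse⁺)

PermWindow : ℕ → ℕ → Permutation′ n → Set
PermWindow {n} l k σ = ∃ λ a → a + l ≤ n ×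
  (∀ i → (toℕ i ∈[ a ,+ l ⟩) ⇔ (toℕ (σ ⟨$⟩ʳ i) ∈[ k ,+ l ⟩))

-- For `suc l` and `suc k` the subtractions in `Clustered` compute, so upper ends carry over
-- unchanged to zero-based form. As `σ` is a bijection, equality of sets amounts to an equivalence
-- at each position.
Clustered⇔PermWindow : (σ : Permutation′ n) → Clustered n (suc l) (suc k) σ ⇔ PermWindow (suc l) k σ
Clustered⇔PermWindow {n} {l} {k} σ = mk⇔
  (λ (a , a≤ , ⊆image , image⊆) → toℕ a , a≤ , λ i → mk⇔
    (λ (p , q) → unlabel (image⊆ (i , (s≤s p , q) , refl)))
    (λ (p , q) → let j , j∈ , eq = ⊆image (s≤s p , q)
                 in subst (λ j → toℕ j ∈[ toℕ a ,+ suc l ⟩) (Injection.injective (↔⇒↣ σ) eq) (unlabel j∈)))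
  from′
  where
  unlabel : ∀ {x y z} → suc x ≤ suc y × z → x ≤ y × z
  unlabel (p , q) = s≤s⁻¹ p , q
  from′ : PermWindow (suc l) k σ → Clustered n (suc l) (suc k) σ
  -- The block is nonempty, so its start is a genuine position.
  from′ (a , a≤ , iff) with a<n ← <-≤-trans (m<m+n a z<s) a≤ =
    fromℕ< a<n , subst (λ b → b + suc l ≤ n) (sym (Finₚ.toℕ-fromℕ< a<n)) a≤ ,
    (λ {v} (p , q) → σ⁻¹ v , relabel (from (iff (σ⁻¹ v))
      (subst (λ w → toℕ w ∈[ k ,+ suc l ⟩) (sym (inverseʳ σ)) (s≤s⁻¹ p , q))) , inverseʳ σ) ,
    λ { (i , (p , q) , refl) → let p′ , q′ = to (iff i) (unrelabel (p , q)) in s≤s p′ , q′ }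
    where
    σ⁻¹ = flip σ ⟨$⟩ʳ_
    relabel : ∀ {i} → toℕ i ∈[ a ,+ suc l ⟩ → interval (label (fromℕ< a<n)) (suc l) i
    relabel (p , q) rewrite Finₚ.toℕ-fromℕ< a<n = s≤s p , q
    unrelabel : ∀ {i} → interval (label (fromℕ< a<n)) (suc l) i → toℕ i ∈[ a ,+ suc l ⟩
    unrelabel pq rewrite Finₚ.toℕ-fromℕ< a<n = s≤s⁻¹ (proj₁ pq) , proj₂ pq

PermWindow⇔Window : (σ : Permutation′ n) → PermWindow l k σ ⇔ Window l k (code σ)
PermWindow⇔Window {n} {l} {k} σ = mk⇔
  (λ (a , a≤ , iff) → a , subst (a + l ≤_) (sym (length-code σ)) a≤ , λ j j< →
    let j<n = subst (j <_) (length-code σ) j<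
    in subst (λ i → (i ∈[ a ,+ l ⟩) ⇔ (val (code σ) i ∈[ k ,+ l ⟩))
         (Finₚ.toℕ-fromℕ< j<n)
         (subst (λ v → (toℕ (fromℕ< j<n) ∈[ a ,+ l ⟩) ⇔ (v ∈[ k ,+ l ⟩))
           (sym (val-code σ (fromℕ< j<n))) (iff (fromℕ< j<n))))
  (λ (a , a≤ , iff) → a , subst (a + l ≤_) (length-code σ) a≤ , λ i →
    subst (λ v → (toℕ i ∈[ a ,+ l ⟩) ⇔ (v ∈[ k ,+ l ⟩)) (val-code σ i)
      (iff (toℕ i) (subst (toℕ i <_) (sym (length-code σ)) (Finₚ.toℕ<n i))))

Clustered⇔Cl : (σ : Permutation′ n) → Clustered n (suc l) (suc k) σ ⇔ Cl (suc l) k (code σ)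
Clustered⇔Cl σ =
  mk⇔ (Window⇒Cl _ _ (code σ)) Cl⇒Window ⇔-∘ (PermWindow⇔Window σ ⇔-∘ Clustered⇔PermWindow σ)

-- For positions `x` and `y` that mirror each other, reflection turns the lower end of an interval
-- into an upper end.
mirror : ∀ {x y u w} → suc x + y ≡ u + w → (u ≤ x) ⇔ (y < w)
mirror {x} {y} {u} {w} eq = mk⇔
  (λ u≤x → ≰⇒> λ w≤y → <⇒≱ (≤-reflexive eq) (+-mono-≤ u≤x w≤y))
  (λ y<w → ≮⇒≥ λ x<u → <⇒≱ (≤-reflexive (sym (+-suc _ y)))
    (≤-trans (+-mono-≤ x<u y<w) (≤-reflexive (sym eq))))

suc+opposite : (i : Fin n) → suc (toℕ i) + toℕ (opposite i) ≡ n
suc+opposite i = trans (cong (suc (toℕ i) +_) (Finₚ.opposite-prop i)) (m+[n∸m]≡n (Finₚ.toℕ<n i))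

PermWindow-reverse : (σ : Permutation′ n) → PermWindow l k σ → PermWindow l k (reverse ∘ₚ σ)
PermWindow-reverse {n} {l} {k} σ (a , a≤ , iff) = b , subst (b + l ≤_) b+l+a≡n (m≤m+n (b + l) a) , λ i →
  iff (opposite i) ⇔-∘ mk⇔
    (λ (p , q) → from (left i) q , to (right i) p)
    (λ (p , q) → from (right i) q , to (left i) p)
  where
  -- The number of positions to the right of the window, which is where its mirror image starts.
  b = n ∸ (a + l)
  b+[a+l]≡n : b + (a + l) ≡ n
  b+[a+l]≡n = m∸n+n≡m a≤
  b+l+a≡n : b + l + a ≡ n
  b+l+a≡n = trans (trans (+-assoc b l a) (cong (b +_) (+-comm l a))) b+[a+l]≡n
  right : ∀ i → (b ≤ toℕ i) ⇔ (toℕ (opposite i) < a + l)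
  right i = mirror (trans (suc+opposite i) (sym b+[a+l]≡n))
  left : ∀ i → (a ≤ toℕ (opposite i)) ⇔ (toℕ i < b + l)
  left i = mirror (trans (trans (cong suc (+-comm (toℕ (opposite i)) (toℕ i))) (suc+opposite i))
                         (trans (sym b+l+a≡n) (+-comm (b + l) a)))

Clustered-reverse : (σ : Permutation′ n) →
  Clustered n (suc l) (suc k) σ ⇔ Clustered n (suc l) (suc k) (reverse ∘ₚ σ)
Clustered-reverse {l = l} {k} σ =
  ⇔-sym (Clustered⇔PermWindow (reverse ∘ₚ σ)) ⇔-∘
  (mk⇔ (PermWindow-reverse σ) back ⇔-∘ Clustered⇔PermWindow σ)
  where
  back : PermWindow (suc l) k (reverse ∘ₚ σ) → PermWindow (suc l) k σ
  back w with PermWindow-reverse (reverse ∘ₚ σ) w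
  ... | a , a≤ , iff = a , a≤ , λ i →
    subst (λ j → (toℕ i ∈[ a ,+ suc l ⟩) ⇔ (toℕ (σ ⟨$⟩ʳ j) ∈[ k ,+ suc l ⟩))
      (Finₚ.opposite-involutive i) (iff i)

-- Reversing positions exchanges 123 and 321 and keeps contiguous blocks of values contiguous.
record Normalises (τ : Permutation′ 3) (ω : Permutation′ n) : Set where
  field
    avoids⇔    : ∀ σ → Avoids τ σ ⇔ Av (code (ω ∘ₚ σ))
    clustered⇔ : ∀ l k σ → Clustered n (suc l) (suc k) σ ⇔ Cl (suc l) k (code (ω ∘ₚ σ))

normalises : (τ : Permutation′ 3) → τ ≈ τ₁₂₃ ⊎ τ ≈ τ₃₂₁ →
             ∃ λ (ω : Permutation′ n) → Normalises τ ω
normalises τ (inj₁ τ≈123) = reverse , record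
  { avoids⇔    = λ σ →
      Avoids⇔Av (reverse ∘ₚ τ) (λ i → τ≈123 (opposite i)) (reverse ∘ₚ σ) ⇔-∘ Avoids-reverse τ σ
  ; clustered⇔ = λ l k σ → Clustered⇔Cl (reverse ∘ₚ σ) ⇔-∘ Clustered-reverse σ
  }
normalises τ (inj₂ τ≈321) = id , record
  { avoids⇔    = λ σ → Avoids⇔Av τ τ≈321 (id ∘ₚ σ)
  ; clustered⇔ = λ l k σ → Clustered⇔Cl (id ∘ₚ σ)
  }

-- Probabilities

-- Given in lowest terms, so that numerator and denominator compute; `_/_` would pass through a gcd.
fromℕ : ℕ → ℚ
fromℕ a = mkℚ (ℤ.+ a) 0 (Coprimality.sym (Coprimality.1-coprimeTo a))

/1≡fromℕ : ∀ a → ℤ.+ a / 1 ≡ fromℕ a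
/1≡fromℕ a = ℚₚ.↥p/↧p≡p (fromℕ a)

fromℕ-homo-+ : ∀ a b → fromℕ a +ℚ fromℕ b ≡ fromℕ (a + b)
fromℕ-homo-+ a b = trans
  (ℚₚ./-cong (cong₂ ℤ._+_ (ℤₚ.*-identityʳ (ℤ.+ a)) (ℤₚ.*-identityʳ (ℤ.+ b))) refl)
  (/1≡fromℕ (a + b))

fromℕ-homo-* : ∀ a b → fromℕ a *ℚ fromℕ b ≡ fromℕ (a * b)
fromℕ-homo-* a b = trans (ℚₚ./-cong (sym (ℤₚ.pos-* a b)) refl) (/1≡fromℕ (a * b))

fromℕ-pred : ∀ a → fromℕ (suc a) -ℚ 1ℚ ≡ fromℕ a
fromℕ-pred a = begin
  fromℕ (suc a) -ℚ 1ℚ          ≡⟨ cong (λ b → fromℕ b -ℚ 1ℚ) (+-comm 1 a) ⟩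
  fromℕ (a + 1) -ℚ 1ℚ          ≡⟨ cong (_-ℚ 1ℚ) (fromℕ-homo-+ a 1) ⟨
  fromℕ a +ℚ 1ℚ -ℚ 1ℚ          ≡⟨ ℚₚ.+-assoc (fromℕ a) 1ℚ (ℚ.- 1ℚ) ⟩
  fromℕ a +ℚ (1ℚ -ℚ 1ℚ)        ≡⟨ ℚₚ.+-identityʳ (fromℕ a) ⟩
  fromℕ a ∎
  where open ≡-Reasoning

/≡÷ : ∀ a b .{{_ : NonZero b}} .{{_ : ℚ.NonZero (fromℕ b)}} → ℤ.+ a / b ≡ fromℕ a ÷ fromℕ b
/≡÷ a (suc b) = sym (ℚₚ./-cong (ℤₚ.*-identityʳ (ℤ.+ a)) (*-identityˡ (suc b)))

÷-cong : ∀ {p p′ q q′} .{{_ : ℚ.NonZero q}} .{{_ : ℚ.NonZero q′}} →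
         p ≡ p′ → q ≡ q′ → p ÷ q ≡ p′ ÷ q′
÷-cong refl refl = refl

suc*/suc : ∀ d a → ℤ.+ (suc d * a) / suc d ≡ fromℕ a
suc*/suc d a = trans (ℚₚ.fromℚᵘ-cong {mkℚᵘ (ℤ.+ (suc d * a)) d} {mkℚᵘ (ℤ.+ a) 0} (*≡* (begin
  ℤ.+ (suc d * a) ℤ.* ℤ.+ 1   ≡⟨ ℤₚ.*-identityʳ (ℤ.+ (suc d * a)) ⟩
  ℤ.+ (suc d * a)             ≡⟨ cong ℤ.+_ (*-comm (suc d) a) ⟩
  ℤ.+ (a * suc d)             ≡⟨ ℤₚ.pos-* a (suc d) ⟩
  ℤ.+ a ℤ.* ℤ.+ suc d         ∎))) (/1≡fromℕ a)
  where open ≡-Reasoning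

-- The division by `suc j` is exact, with the number of codes as quotient.
catalan≡fromℕ : ∀ j → catalan j ≡ fromℕ (length (avs j))
catalan≡fromℕ j = trans (ℚₚ./-cong (cong ℤ.+_ (sym (suc*length-avs j))) refl)
                        (suc*/suc j (length (avs j)))

module _ (τ : Permutation′ 3) (τ∈ : τ ≈ τ₁₂₃ ⊎ τ ≈ τ₃₂₁) where

  ∣avoids∣ : ∀ n → ∣ avoids? {n = n} τ ∣ ≡ length (avs n)
  ∣avoids∣ n = ∣∣≡length ω (avoids? τ) (avs-unique n)
    (λ {c} c∈ → let av , len = ∈-avs⁻ n c∈ in Av⇒Valid c av , len)
    λ σ → mk⇔
      (λ avoids → ∈-avs⁺ _ (to (avoids⇔ σ) avoids) (length-code (ω ∘ₚ σ)))
      (λ c∈ → from (avoids⇔ σ) (proj₁ (∈-avs⁻ n c∈)))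
    where
    ω = proj₁ (normalises {n} τ τ∈)
    open Normalises (proj₂ (normalises {n} τ τ∈))

  ∣clustered∩avoids∣ : ∀ n k p r → n ≡ suc k + r + p →
    ∣ clustered? n (suc p) (suc k) ∩? avoids? τ ∣ ≡ length (clusteredAvs p k r)
  ∣clustered∩avoids∣ n k p r n≡ = ∣∣≡length ω
    (clustered? n (suc p) (suc k) ∩? avoids? τ) (clusteredAvs-unique p k r)
    (λ {c} c∈ → let av , _ , len = ∈-clusteredAvs⁻ p k r c∈
               in Av⇒Valid c av , trans len (sym n≡))
    λ σ → mk⇔
      (λ (cl , avoids) → ∈-clusteredAvs⁺ p k r (to (avoids⇔ σ) avoids)
        (to (clustered⇔ p k σ) cl) (trans (length-code (ω ∘ₚ σ)) n≡))
      (λ c∈ → let av , cl , _ = ∈-clusteredAvs⁻ p k r c∈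
              in from (clustered⇔ p k σ) cl , from (avoids⇔ σ) av)
    where
    ω = proj₁ (normalises {n} τ τ∈)
    open Normalises (proj₂ (normalises {n} τ τ∈))

  probability : ∀ n k p r → n ≡ suc k + r + p →
    P[ n , τ ] (clustered? n (suc p) (suc k)) ≡
      ((catalan (suc k + r) +ℚ catalan k *ℚ catalan r *ℚ (catalan (suc p) -ℚ 1ℚ)) ÷ catalan n)
        {{catalan-nonZero n}}
  probability n k p r n≡ = begin
    P[ n , τ ] (clustered? n (suc p) (suc k))
      ≡⟨ ℚₚ./-cong {{∣avoids∣-nonZero n τ}} {{b≢0}}
           (cong ℤ.+_ (∣clustered∩avoids∣ n k p r n≡)) (∣avoids∣ n) ⟩
    (ℤ.+ length (clusteredAvs p k r) / b) {{b≢0}}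
      ≡⟨ /≡÷ (length (clusteredAvs p k r)) b {{b≢0}} {{b′≢0}} ⟩
    (fromℕ (length (clusteredAvs p k r)) ÷ fromℕ b) {{b′≢0}}
      ≡⟨ ÷-cong {{b′≢0}} {{catalan-nonZero n}} numerator (sym (catalan≡fromℕ n)) ⟩
    ((catalan (suc k + r) +ℚ catalan k *ℚ catalan r *ℚ (catalan (suc p) -ℚ 1ℚ)) ÷ catalan n)
      {{catalan-nonZero n}} ∎
    where
    open ≡-Reasoning
    b = length (avs n)
    g = length (nonIdentities (suc p))
    b≢0 : NonZero b
    b≢0 = subst NonZero (∣avoids∣ n) (∣avoids∣-nonZero n τ)
    b′≢0 : ℚ.NonZero (fromℕ b)
    b′≢0 = subst (λ q → ℚ.NonZero q) (catalan≡fromℕ n) (catalan-nonZero n)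
    a : ℕ → ℕ
    a j = length (avs j)
    catalan-1 : catalan (suc p) -ℚ 1ℚ ≡ fromℕ g
    catalan-1 = trans
      (cong (_-ℚ 1ℚ) (trans (catalan≡fromℕ (suc p)) (cong fromℕ (length-nonIdentities (suc p)))))
      (fromℕ-pred g)
    numerator : fromℕ (length (clusteredAvs p k r)) ≡
      catalan (suc k + r) +ℚ catalan k *ℚ catalan r *ℚ (catalan (suc p) -ℚ 1ℚ)
    numerator = begin
      fromℕ (length (clusteredAvs p k r))
        ≡⟨ cong fromℕ (length-clusteredAvs p k r) ⟩
      fromℕ (a (suc k + r) + a k * (g * a r))
        ≡⟨ cong (λ x → fromℕ (a (suc k + r) + x))
             (trans (cong (a k *_) (*-comm g (a r))) (sym (*-assoc (a k) (a r) g))) ⟩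
      fromℕ (a (suc k + r) + a k * a r * g)
        ≡⟨ fromℕ-homo-+ (a (suc k + r)) _ ⟨
      fromℕ (a (suc k + r)) +ℚ fromℕ (a k * a r * g)
        ≡⟨ cong (fromℕ (a (suc k + r)) +ℚ_) (fromℕ-homo-* (a k * a r) g) ⟨
      fromℕ (a (suc k + r)) +ℚ fromℕ (a k * a r) *ℚ fromℕ g
        ≡⟨ cong (λ q → fromℕ (a (suc k + r)) +ℚ q *ℚ fromℕ g) (fromℕ-homo-* (a k) (a r)) ⟨
      fromℕ (a (suc k + r)) +ℚ fromℕ (a k) *ℚ fromℕ (a r) *ℚ fromℕ g
        ≡⟨ cong₂ _+ℚ_ (catalan≡fromℕ (suc k + r))
             (cong₂ _*ℚ_ (cong₂ _*ℚ_ (catalan≡fromℕ k) (catalan≡fromℕ r)) catalan-1) ⟨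
      catalan (suc k + r) +ℚ catalan k *ℚ catalan r *ℚ (catalan (suc p) -ℚ 1ℚ) ∎

theorem3 : (τ : Permutation′ 3) → τ ≈ τ₁₂₃ ⊎ τ ≈ τ₃₂₁ →
    (n l k : ℕ) → 3 ≤ n → 2 ≤ l → l ≤ n ∸ 1 → 1 ≤ k → k + l ∸ 1 ≤ n →
    P[ n , τ ] (clustered? n l k)
    ≡ ((catalan (n ∸ l + 1)
    +ℚ catalan (k ∸ 1) *ℚ catalan (n + 1 ∸ (k + l)) *ℚ (catalan l -ℚ 1ℚ))
    ÷ catalan n) {{catalan-nonZero n}}
theorem3 τ τ∈ n (suc p) (suc k) _ _ _ _ k+l≤n =
  subst₂ (λ i j → P[ n , τ ] (clustered? n (suc p) (suc k)) ≡
    ((catalan i +ℚ catalan k *ℚ catalan j *ℚ (catalan (suc p) -ℚ 1ℚ)) ÷ catalan n)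
      {{catalan-nonZero n}})
    i≡ j≡ (probability τ τ∈ n k p r n≡)
  where
  -- After matching, `k` is one less than the given parameter and counts the values below the block;
  -- `r` counts those above it.
  r = n ∸ (k + suc p)
  open ≡-Reasoning
  n≡ : n ≡ suc k + r + p
  n≡ = trans (sym (m∸n+n≡m k+l≤n)) (lemma k r p)
    where
    lemma : ∀ k r p → r + (k + suc p) ≡ suc k + r + p
    lemma = solve-∀
  i≡ : suc k + r ≡ n ∸ suc p + 1
  i≡ = begin
    suc k + r                  ≡⟨ +-comm 1 (k + r) ⟩
    k + r + 1                  ≡⟨ cong (_+ 1) (m+n∸n≡m (k + r) p) ⟨
    suc k + r + p ∸ suc p + 1  ≡⟨ cong (λ n → n ∸ suc p + 1) n≡ ⟨
    n ∸ suc p + 1              ∎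
  j≡ : r ≡ n + 1 ∸ (suc k + suc p)
  j≡ = begin
    n ∸ (k + suc p)          ≡⟨⟩
    1 + n ∸ (suc k + suc p)  ≡⟨ cong (_∸ (suc k + suc p)) (+-comm 1 n) ⟩
    n + 1 ∸ (suc k + suc p)  ∎
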